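{- Let $G$ be a finite simple graph. Then the center $Z(A_G)$ is one-dimensional (i.e. $Z(A_G)=\mathbb{C}\cdot 1$) if and only if the determinant of the adjacency matrix of $G$ (an integer) is odd.
   Context: All graphs are finite, with at least one vertex, no loops and no multiple edges. For a graph $G$ with vertices numbered $1,\dots,n$, the Clifford graph algebra $A_G$ is the unital associative $\mathbb{C}$-algebra generated by $e_1,\dots,e_n$ subject to the relations $e_i^2=-1$ for all $i$; $e_ie_j=-e_je_i$ if $i\neq j$ and vertices $i,j$ are adjacent; and $e_ie_j=e_je_i$ if $i\ne j$ and vertices $i,j$ are not adjacent. $Z(A)$ denotes the center. The adjacency matrix of $G$ is the $n\times n$ $0/1$ matrix $(a_{ij})$ with $a_{ij}=1$ iff vertices $i,j$ are adjacent. -}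

module Defs where

open import Algebra.Bundles using (Ring; CommutativeRing)
open import Algebra.Module.Bundles using (Module)
open import Algebra.Module.Structures using (IsLeftModule)
open import Algebra.Module.Structures.Biased using (module IsModuleFromLeft)
open import Algebra.Morphism.Structures using (module RingMorphisms)
open import Algebra.Structures using (IsRing)
import Algebra.Definitions.RawMonoid as RawMonoidDefinitions
import Algebra.Properties.Group as GroupProperties
import Algebra.Properties.Ring as RingProperties
import Algebra.Solver.Ring.NaturalCoefficients.Default as NaturalSolver
open import Data.Bool.Base using (if_then_else_)
open import Data.Fin.Base using (Fin; zero; suc; toℕ; punchIn)
open import Data.Integer.Base as ℤ using (ℤ; 0ℤ; 1ℤ; -1ℤ)
import Data.Integer.Properties as ℤ
open import Data.Nat.Base as ℕ using (ℕ; zero; suc)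
import Data.Nat.Properties as ℕ
open import Data.Product.Base using (Σ; ∃; _×_; _,_; proj₁; proj₂)
open import Data.Rational.Base as ℚ using (ℚ; 0ℚ; 1ℚ; ½; ∣_∣; Positive; positive; 1/_)
import Data.Rational.Properties as ℚ
open import Data.Rational.Solver using (module +-*-Solver)
open import Data.Vec.Functional using (Vector)
open import Level using (Level; _⊔_; 0ℓ) renaming (suc to lsuc)
open import Relation.Binary.Core using (Rel)
open import Relation.Binary.Definitions using (Decidable; Symmetric; Irreflexive)
open import Relation.Binary.PropositionalEquality as ≡ using (_≡_)
import Relation.Binary.Reasoning.Setoid as SetoidReasoning
open import Relation.Binary.Structures using (IsEquivalence)
open import Relation.Nullary.Decidable using (does)
open import Relation.Nullary.Negation using (¬_)

private variable
  c ℓ a ℓa : Level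

-- A real number is a Cauchy sequence of rationals; two of them are
-- identified (_≈ℝ_) when their difference tends to 0.

IsCauchy : (ℕ → ℚ) → Set
IsCauchy x = ∀ ε → 0ℚ ℚ.< ε →
  ∃ λ N → ∀ m n → N ℕ.≤ m → N ℕ.≤ n → ∣ x m ℚ.- x n ∣ ℚ.< ε

-- No eta, and operations defined by copatterns: conversion checking then
-- compares sums and products of reals without unfolding the Cauchy proofs.
record ℝ : Set where
  no-eta-equality
  field
    seq      : ℕ → ℚ
    isCauchy : IsCauchy seq

open ℝ public

infix 4 _≈ℝ_

record _≈ℝ_ (x y : ℝ) : Set where
  constructor mk≈
  field
    close : ∀ ε → 0ℚ ℚ.< ε → ∃ λ N → ∀ n → N ℕ.≤ n → ∣ seq x n ℚ.- seq y n ∣ ℚ.< ε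

open _≈ℝ_ public

private
  half-pos : ∀ {ε} → 0ℚ ℚ.< ε → 0ℚ ℚ.< ε ℚ.* ½
  half-pos {ε} 0<ε = ℚ.positive⁻¹ (ε ℚ.* ½) {{ℚ.pos*pos⇒pos ε {{positive 0<ε}} ½}}

  half+half : ∀ ε → ε ℚ.* ½ ℚ.+ ε ℚ.* ½ ≡ ε
  half+half ε = ≡.trans (≡.sym (ℚ.*-distribˡ-+ ε ½ ½)) (ℚ.*-identityʳ ε)

  triangle : ∀ {ε} p q → ∣ p ∣ ℚ.< ε ℚ.* ½ → ∣ q ∣ ℚ.< ε ℚ.* ½ → ∣ p ℚ.+ q ∣ ℚ.< ε
  triangle {ε} p q p< q< = begin-strict
    ∣ p ℚ.+ q ∣           ≤⟨ ℚ.∣p+q∣≤∣p∣+∣q∣ p q ⟩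
    ∣ p ∣ ℚ.+ ∣ q ∣       <⟨ ℚ.+-mono-< p< q< ⟩
    ε ℚ.* ½ ℚ.+ ε ℚ.* ½   ≡⟨ half+half ε ⟩
    ε                     ∎
    where open ℚ.≤-Reasoning

  self-close : ∀ p {ε} → 0ℚ ℚ.< ε → ∣ p ℚ.- p ∣ ℚ.< ε
  self-close p 0<ε rewrite ℚ.+-inverseʳ p = 0<ε

  close-sym : ∀ p q {ε} → ∣ p ℚ.- q ∣ ℚ.< ε → ∣ q ℚ.- p ∣ ℚ.< ε
  close-sym p q = ≡.subst (ℚ._< _) (≡.trans (≡.sym (ℚ.∣-p∣≡∣p∣ (p ℚ.- q))) (≡.cong ∣_∣ lemma))
    where
    lemma : ℚ.- (p ℚ.- q) ≡ q ℚ.- p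
    lemma = solve 2 (λ p q → :- (p :- q) := q :- p) ≡.refl p q
      where open +-*-Solver

  close-trans : ∀ p q r {ε} → ∣ p ℚ.- q ∣ ℚ.< ε ℚ.* ½ → ∣ q ℚ.- r ∣ ℚ.< ε ℚ.* ½ →
                ∣ p ℚ.- r ∣ ℚ.< ε
  close-trans p q r p~q q~r =
    ≡.subst (λ x → ∣ x ∣ ℚ.< _) lemma (triangle (p ℚ.- q) (q ℚ.- r) p~q q~r)
    where
    lemma : (p ℚ.- q) ℚ.+ (q ℚ.- r) ≡ p ℚ.- r
    lemma = solve 3 (λ p q r → (p :- q) :+ (q :- r) := p :- r) ≡.refl p q r
      where open +-*-Solver

  close-neg : ∀ p q {ε} → ∣ p ℚ.- q ∣ ℚ.< ε → ∣ ℚ.- p ℚ.- ℚ.- q ∣ ℚ.< ε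
  close-neg p q p~q = ≡.subst (λ x → ∣ x ∣ ℚ.< _) lemma (close-sym p q p~q)
    where
    lemma : q ℚ.- p ≡ ℚ.- p ℚ.- ℚ.- q
    lemma = solve 2 (λ p q → q :- p := :- p :- :- q) ≡.refl p q
      where open +-*-Solver

  close-+ : ∀ p q r s {ε} → ∣ p ℚ.- r ∣ ℚ.< ε ℚ.* ½ → ∣ q ℚ.- s ∣ ℚ.< ε ℚ.* ½ →
            ∣ (p ℚ.+ q) ℚ.- (r ℚ.+ s) ∣ ℚ.< ε
  close-+ p q r s p~r q~s =
    ≡.subst (λ x → ∣ x ∣ ℚ.< _) lemma (triangle (p ℚ.- r) (q ℚ.- s) p~r q~s)
    where
    lemma : (p ℚ.- r) ℚ.+ (q ℚ.- s) ≡ (p ℚ.+ q) ℚ.- (r ℚ.+ s)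
    lemma = solve 4 (λ p q r s → (p :- r) :+ (q :- s) := (p :+ q) :- (r :+ s))
                  ≡.refl p q r s
      where open +-*-Solver

  module _ (ε B : ℚ) (0<ε : 0ℚ ℚ.< ε) (0<B : 0ℚ ℚ.< B) where
    private instance
      B-pos : Positive B
      B-pos = positive 0<B
      B-nonZero : ℚ.NonZero B
      B-nonZero = ℚ.pos⇒nonZero B

    tol : ℚ
    tol = (1/ B) ℚ.* (ε ℚ.* ½)

    tol-pos : 0ℚ ℚ.< tol
    tol-pos = ℚ.positive⁻¹ tol
      {{ℚ.pos*pos⇒pos (1/ B) {{ℚ.1/pos⇒pos B}} (ε ℚ.* ½) {{positive (half-pos 0<ε)}}}}

    private
      bound : ∀ p q → ∣ p ∣ ℚ.< B → ∣ q ∣ ℚ.< tol → ∣ p ℚ.* q ∣ ℚ.< ε ℚ.* ½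
      bound p q p<B q<t = begin-strict
        ∣ p ℚ.* q ∣         ≡⟨ ℚ.∣p*q∣≡∣p∣*∣q∣ p q ⟩
        ∣ p ∣ ℚ.* ∣ q ∣     ≤⟨ ℚ.*-monoˡ-≤-nonNeg ∣ p ∣ {{ℚ.∣-∣-nonNeg p}} (ℚ.<⇒≤ q<t) ⟩
        ∣ p ∣ ℚ.* tol       <⟨ ℚ.*-monoˡ-<-pos tol {{positive tol-pos}} p<B ⟩
        B ℚ.* tol           ≡⟨ ℚ.*-assoc B (1/ B) (ε ℚ.* ½) ⟨
        B ℚ.* (1/ B) ℚ.* (ε ℚ.* ½) ≡⟨ ≡.cong (ℚ._* (ε ℚ.* ½)) (ℚ.*-inverseʳ B) ⟩
        1ℚ ℚ.* (ε ℚ.* ½)    ≡⟨ ℚ.*-identityˡ (ε ℚ.* ½) ⟩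
        ε ℚ.* ½             ∎
        where open ℚ.≤-Reasoning

    close-* : ∀ p q r s → ∣ p ∣ ℚ.< B → ∣ s ∣ ℚ.< B →
              ∣ p ℚ.- r ∣ ℚ.< tol → ∣ q ℚ.- s ∣ ℚ.< tol →
              ∣ p ℚ.* q ℚ.- r ℚ.* s ∣ ℚ.< ε
    close-* p q r s p<B s<B p~r q~s = ≡.subst (λ x → ∣ x ∣ ℚ.< ε) lemma
      (triangle (p ℚ.* (q ℚ.- s)) (s ℚ.* (p ℚ.- r))
                (bound p (q ℚ.- s) p<B q~s) (bound s (p ℚ.- r) s<B p~r))
      where
      lemma : p ℚ.* (q ℚ.- s) ℚ.+ s ℚ.* (p ℚ.- r) ≡ p ℚ.* q ℚ.- r ℚ.* s
      lemma = solve 4 (λ p q r s → p :* (q :- s) :+ s :* (p :- r) := p :* q :- r :* s)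
                    ≡.refl p q r s
        where open +-*-Solver

  eventuallyBounded : ∀ x → IsCauchy x → ∃ λ B → ∃ λ N → ∀ n → N ℕ.≤ n → ∣ x n ∣ ℚ.< B
  eventuallyBounded x cx =
    let N , h = cx 1ℚ (ℚ.positive⁻¹ 1ℚ) in
    1ℚ ℚ.+ ∣ x N ∣ , N , λ n N≤n → bound (x n) (x N) (h n N N≤n ℕ.≤-refl)
    where
    bound : ∀ p q → ∣ p ℚ.- q ∣ ℚ.< 1ℚ → ∣ p ∣ ℚ.< 1ℚ ℚ.+ ∣ q ∣
    bound p q p~q = begin-strict
      ∣ p ∣                     ≡⟨ ≡.cong ∣_∣ lemma ⟩
      ∣ (p ℚ.- q) ℚ.+ q ∣       ≤⟨ ℚ.∣p+q∣≤∣p∣+∣q∣ (p ℚ.- q) q ⟩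
      ∣ p ℚ.- q ∣ ℚ.+ ∣ q ∣     <⟨ ℚ.+-monoˡ-< ∣ q ∣ p~q ⟩
      1ℚ ℚ.+ ∣ q ∣              ∎
      where
      open ℚ.≤-Reasoning
      lemma : p ≡ (p ℚ.- q) ℚ.+ q
      lemma = solve 2 (λ p q → p := (p :- q) :+ q) ≡.refl p q
        where open +-*-Solver

  commonBound : ∀ x y → IsCauchy x → IsCauchy y →
    ∃ λ B → 0ℚ ℚ.< B × ∃ λ N → ∀ n → N ℕ.≤ n → ∣ x n ∣ ℚ.< B × ∣ y n ∣ ℚ.< B
  commonBound x y cx cy =
    let B₁ , N₁ , h₁ = eventuallyBounded x cx
        B₂ , N₂ , h₂ = eventuallyBounded y cy
    in combine B₁ N₁ h₁ B₂ N₂ h₂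
    where
    combine : ∀ B₁ N₁ → (∀ n → N₁ ℕ.≤ n → ∣ x n ∣ ℚ.< B₁) →
              ∀ B₂ N₂ → (∀ n → N₂ ℕ.≤ n → ∣ y n ∣ ℚ.< B₂) →
              ∃ λ B → 0ℚ ℚ.< B × ∃ λ N → ∀ n → N ℕ.≤ n → ∣ x n ∣ ℚ.< B × ∣ y n ∣ ℚ.< B
    combine B₁ N₁ h₁ B₂ N₂ h₂ =
      B₁ ℚ.⊔ B₂
      , ℚ.≤-<-trans (ℚ.0≤∣p∣ (x N₁)) (x<B N₁ ℕ.≤-refl)
      , N₁ ℕ.⊔ N₂
      , λ n N≤n → x<B n (ℕ.≤-trans (ℕ.m≤m⊔n N₁ N₂) N≤n)
                , y<B n (ℕ.≤-trans (ℕ.m≤n⊔m N₁ N₂) N≤n)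
      where
      x<B : ∀ n → N₁ ℕ.≤ n → ∣ x n ∣ ℚ.< B₁ ℚ.⊔ B₂
      x<B n N₁≤n = ℚ.<-≤-trans (h₁ n N₁≤n) (ℚ.p≤p⊔q B₁ B₂)
      y<B : ∀ n → N₂ ℕ.≤ n → ∣ y n ∣ ℚ.< B₁ ℚ.⊔ B₂
      y<B n N₂≤n = ℚ.<-≤-trans (h₂ n N₂≤n) (ℚ.p≤q⊔p B₁ B₂)

infixl 6 _+ℝ_
infixl 7 _*ℝ_
infix  8 -ℝ_

constℝ : ℚ → ℝ
seq      (constℝ q) _ = q
isCauchy (constℝ q) ε 0<ε = 0 , λ _ _ _ _ → self-close q 0<ε

0ℝ 1ℝ : ℝ
0ℝ = constℝ 0ℚ
1ℝ = constℝ 1ℚ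

_+ℝ_ : ℝ → ℝ → ℝ
seq      (x +ℝ y) n = seq x n ℚ.+ seq y n
isCauchy (x +ℝ y) ε 0<ε =
    let N₁ , h₁ = isCauchy x (ε ℚ.* ½) (half-pos 0<ε)
        N₂ , h₂ = isCauchy y (ε ℚ.* ½) (half-pos 0<ε)
    in N₁ ℕ.⊔ N₂ , λ m n N≤m N≤n →
    close-+ (seq x m) (seq y m) (seq x n) (seq y n)
      (h₁ m n (ℕ.≤-trans (ℕ.m≤m⊔n N₁ N₂) N≤m) (ℕ.≤-trans (ℕ.m≤m⊔n N₁ N₂) N≤n))
      (h₂ m n (ℕ.≤-trans (ℕ.m≤n⊔m N₁ N₂) N≤m) (ℕ.≤-trans (ℕ.m≤n⊔m N₁ N₂) N≤n))

-ℝ_ : ℝ → ℝ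
seq      (-ℝ x) n = ℚ.- seq x n
isCauchy (-ℝ x) ε 0<ε =
    let N , h = isCauchy x ε 0<ε in
    N , λ m n N≤m N≤n → close-neg (seq x m) (seq x n) (h m n N≤m N≤n)

_*ℝ_ : ℝ → ℝ → ℝ
seq      (x *ℝ y) n = seq x n ℚ.* seq y n
isCauchy (x *ℝ y) ε 0<ε =
    let B , 0<B , N₀ , h₀ = commonBound (seq x) (seq y) (isCauchy x) (isCauchy y)
        N₁ , h₁ = isCauchy x (tol ε B 0<ε 0<B) (tol-pos ε B 0<ε 0<B)
        N₂ , h₂ = isCauchy y (tol ε B 0<ε 0<B) (tol-pos ε B 0<ε 0<B)
        le₀ = ℕ.m≤m⊔n N₀ (N₁ ℕ.⊔ N₂)
        le₁ = ℕ.≤-trans (ℕ.m≤m⊔n N₁ N₂) (ℕ.m≤n⊔m N₀ (N₁ ℕ.⊔ N₂))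
        le₂ = ℕ.≤-trans (ℕ.m≤n⊔m N₁ N₂) (ℕ.m≤n⊔m N₀ (N₁ ℕ.⊔ N₂))
    in N₀ ℕ.⊔ (N₁ ℕ.⊔ N₂) , λ m n N≤m N≤n →
      close-* ε B 0<ε 0<B (seq x m) (seq y m) (seq x n) (seq y n)
        (proj₁ (h₀ m (ℕ.≤-trans le₀ N≤m)))
        (proj₂ (h₀ n (ℕ.≤-trans le₀ N≤n)))
        (h₁ m n (ℕ.≤-trans le₁ N≤m) (ℕ.≤-trans le₁ N≤n))
        (h₂ m n (ℕ.≤-trans le₂ N≤m) (ℕ.≤-trans le₂ N≤n))

private
  pointwise : ∀ {x y} → (∀ n → seq x n ≡ seq y n) → x ≈ℝ y
  pointwise {x} {y} eq = mk≈ λ ε 0<ε → 0 , λ n _ →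
    ≡.subst (λ q → ∣ seq x n ℚ.- q ∣ ℚ.< ε) (eq n) (self-close (seq x n) 0<ε)

  ≈ℝ-isEquivalence : IsEquivalence _≈ℝ_
  ≈ℝ-isEquivalence = record
    { refl  = pointwise (λ _ → ≡.refl)
    ; sym   = λ {x} {y} x≈y → mk≈ λ ε 0<ε →
        let N , h = close x≈y ε 0<ε in
        N , λ n N≤n → close-sym (seq x n) (seq y n) (h n N≤n)
    ; trans = λ {x} {y} {z} x≈y y≈z → mk≈ λ ε 0<ε →
        let N₁ , h₁ = close x≈y (ε ℚ.* ½) (half-pos 0<ε)
            N₂ , h₂ = close y≈z (ε ℚ.* ½) (half-pos 0<ε)
        in N₁ ℕ.⊔ N₂ , λ n N≤n → close-trans (seq x n) (seq y n) (seq z n)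
             (h₁ n (ℕ.≤-trans (ℕ.m≤m⊔n N₁ N₂) N≤n))
             (h₂ n (ℕ.≤-trans (ℕ.m≤n⊔m N₁ N₂) N≤n))
    }

  +ℝ-cong : ∀ {x y u v} → x ≈ℝ y → u ≈ℝ v → x +ℝ u ≈ℝ y +ℝ v
  +ℝ-cong {x} {y} {u} {v} x≈y u≈v = mk≈ λ ε 0<ε →
    let N₁ , h₁ = close x≈y (ε ℚ.* ½) (half-pos 0<ε)
        N₂ , h₂ = close u≈v (ε ℚ.* ½) (half-pos 0<ε)
    in N₁ ℕ.⊔ N₂ , λ n N≤n → close-+ (seq x n) (seq u n) (seq y n) (seq v n)
         (h₁ n (ℕ.≤-trans (ℕ.m≤m⊔n N₁ N₂) N≤n))
         (h₂ n (ℕ.≤-trans (ℕ.m≤n⊔m N₁ N₂) N≤n))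

  -ℝ-cong : ∀ {x y} → x ≈ℝ y → -ℝ x ≈ℝ -ℝ y
  -ℝ-cong {x} {y} x≈y = mk≈ λ ε 0<ε →
    let N , h = close x≈y ε 0<ε in
    N , λ n N≤n → close-neg (seq x n) (seq y n) (h n N≤n)

  *ℝ-cong : ∀ {x y u v} → x ≈ℝ y → u ≈ℝ v → x *ℝ u ≈ℝ y *ℝ v
  *ℝ-cong {x} {y} {u} {v} x≈y u≈v = mk≈ λ ε 0<ε →
    let B , 0<B , N₀ , h₀ = commonBound (seq x) (seq v) (isCauchy x) (isCauchy v)
        N₁ , h₁ = close x≈y (tol ε B 0<ε 0<B) (tol-pos ε B 0<ε 0<B)
        N₂ , h₂ = close u≈v (tol ε B 0<ε 0<B) (tol-pos ε B 0<ε 0<B)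
        le₁ = ℕ.≤-trans (ℕ.m≤m⊔n N₁ N₂) (ℕ.m≤n⊔m N₀ (N₁ ℕ.⊔ N₂))
        le₂ = ℕ.≤-trans (ℕ.m≤n⊔m N₁ N₂) (ℕ.m≤n⊔m N₀ (N₁ ℕ.⊔ N₂))
    in N₀ ℕ.⊔ (N₁ ℕ.⊔ N₂) , λ n N≤n →
      let xn<B , vn<B = h₀ n (ℕ.≤-trans (ℕ.m≤m⊔n N₀ (N₁ ℕ.⊔ N₂)) N≤n) in
      close-* ε B 0<ε 0<B (seq x n) (seq u n) (seq y n) (seq v n) xn<B vn<B
        (h₁ n (ℕ.≤-trans le₁ N≤n)) (h₂ n (ℕ.≤-trans le₂ N≤n))

ℝ-commutativeRing : CommutativeRing 0ℓ 0ℓ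
ℝ-commutativeRing = record
  { Carrier = ℝ
  ; _≈_     = _≈ℝ_
  ; _+_     = _+ℝ_
  ; _*_     = _*ℝ_
  ; -_      = -ℝ_
  ; 0#      = 0ℝ
  ; 1#      = 1ℝ
  ; isCommutativeRing = record
    { isRing = record
      { +-isAbelianGroup = record
        { isGroup = record
          { isMonoid = record
            { isSemigroup = record
              { isMagma = record { isEquivalence = ≈ℝ-isEquivalence ; ∙-cong = +ℝ-cong }
              ; assoc = λ x y z → pointwise λ n → ℚ.+-assoc (seq x n) (seq y n) (seq z n)
              }
            ; identity = (λ x → pointwise λ n → ℚ.+-identityˡ (seq x n))
                       , (λ x → pointwise λ n → ℚ.+-identityʳ (seq x n))
            }
          ; inverse = (λ x → pointwise λ n → ℚ.+-inverseˡ (seq x n))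
                    , (λ x → pointwise λ n → ℚ.+-inverseʳ (seq x n))
          ; ⁻¹-cong = -ℝ-cong
          }
        ; comm = λ x y → pointwise λ n → ℚ.+-comm (seq x n) (seq y n)
        }
      ; *-cong = *ℝ-cong
      ; *-assoc = λ x y z → pointwise λ n → ℚ.*-assoc (seq x n) (seq y n) (seq z n)
      ; *-identity = (λ x → pointwise λ n → ℚ.*-identityˡ (seq x n))
                   , (λ x → pointwise λ n → ℚ.*-identityʳ (seq x n))
      ; distrib = (λ x y z → pointwise λ n → ℚ.*-distribˡ-+ (seq x n) (seq y n) (seq z n))
                , (λ x y z → pointwise λ n → ℚ.*-distribʳ-+ (seq x n) (seq y n) (seq z n))
      }
    ; *-comm = λ x y → pointwise λ n → ℚ.*-comm (seq x n) (seq y n)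
    }
  }

record ℂ : Set where
  constructor _+i_
  field
    re im : ℝ

open ℂ public

infix 4 _≈ℂ_

record _≈ℂ_ (z w : ℂ) : Set where
  constructor _,_
  field
    re≈ : re z ≈ℝ re w
    im≈ : im z ≈ℝ im w

open _≈ℂ_ public

infixl 6 _+ℂ_
infixl 7 _*ℂ_
infix  8 -ℂ_

0ℂ 1ℂ : ℂ
0ℂ = 0ℝ +i 0ℝ
1ℂ = 1ℝ +i 0ℝ

_+ℂ_ _*ℂ_ : ℂ → ℂ → ℂ
z +ℂ w = (re z +ℝ re w) +i (im z +ℝ im w)
z *ℂ w = (re z *ℝ re w +ℝ -ℝ (im z *ℝ im w)) +i (re z *ℝ im w +ℝ im z *ℝ re w)

-ℂ_ : ℂ → ℂ
-ℂ z = (-ℝ re z) +i (-ℝ im z)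

private
  -- Proved over an arbitrary ring so that the solver never unfolds ℝ.
  module ComplexLaws {c ℓ} (R : CommutativeRing c ℓ) where
    open CommutativeRing R
    open NaturalSolver commutativeSemiring
    open RingProperties ring using (-0#≈0#; -1*x≈-x)
    open SetoidReasoning setoid

    private
      m : Carrier
      m = - 1#

      neg : ∀ x → - x ≈ m * x
      neg x = sym (-1*x≈-x x)

    assoc-re : ∀ a b c d e f →
      (a * c + - (b * d)) * e + - ((a * d + b * c) * f) ≈
      a * (c * e + - (d * f)) + - (b * (c * f + d * e))
    assoc-re a b c d e f = begin
      (a * c + - (b * d)) * e + - ((a * d + b * c) * f)
        ≈⟨ +-cong (*-congʳ (+-congˡ (neg _))) (neg _) ⟩
      (a * c + m * (b * d)) * e + m * ((a * d + b * c) * f)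
        ≈⟨ solve 7 (λ m a b c d e f →
             (a :* c :+ m :* (b :* d)) :* e :+ m :* ((a :* d :+ b :* c) :* f) :=
             a :* (c :* e :+ m :* (d :* f)) :+ m :* (b :* (c :* f :+ d :* e)))
             refl m a b c d e f ⟩
      a * (c * e + m * (d * f)) + m * (b * (c * f + d * e))
        ≈⟨ +-cong (*-congˡ (+-congˡ (neg _))) (neg _) ⟨
      a * (c * e + - (d * f)) + - (b * (c * f + d * e)) ∎

    assoc-im : ∀ a b c d e f →
      (a * c + - (b * d)) * f + (a * d + b * c) * e ≈
      a * (c * f + d * e) + b * (c * e + - (d * f))
    assoc-im a b c d e f = begin
      (a * c + - (b * d)) * f + (a * d + b * c) * e
        ≈⟨ +-congʳ (*-congʳ (+-congˡ (neg _))) ⟩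
      (a * c + m * (b * d)) * f + (a * d + b * c) * e
        ≈⟨ solve 7 (λ m a b c d e f →
             (a :* c :+ m :* (b :* d)) :* f :+ (a :* d :+ b :* c) :* e :=
             a :* (c :* f :+ d :* e) :+ b :* (c :* e :+ m :* (d :* f)))
             refl m a b c d e f ⟩
      a * (c * f + d * e) + b * (c * e + m * (d * f))
        ≈⟨ +-congˡ (*-congˡ (+-congˡ (neg _))) ⟨
      a * (c * f + d * e) + b * (c * e + - (d * f)) ∎

    distribˡ-re : ∀ a b c d e f →
      a * (c + e) + - (b * (d + f)) ≈ (a * c + - (b * d)) + (a * e + - (b * f))
    distribˡ-re a b c d e f = begin
      a * (c + e) + - (b * (d + f))
        ≈⟨ +-congˡ (neg _) ⟩
      a * (c + e) + m * (b * (d + f))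
        ≈⟨ solve 7 (λ m a b c d e f →
             a :* (c :+ e) :+ m :* (b :* (d :+ f)) :=
             (a :* c :+ m :* (b :* d)) :+ (a :* e :+ m :* (b :* f)))
             refl m a b c d e f ⟩
      (a * c + m * (b * d)) + (a * e + m * (b * f))
        ≈⟨ +-cong (+-congˡ (neg _)) (+-congˡ (neg _)) ⟨
      (a * c + - (b * d)) + (a * e + - (b * f)) ∎

    distribˡ-im : ∀ a b c d e f →
      a * (d + f) + b * (c + e) ≈ (a * d + b * c) + (a * f + b * e)
    distribˡ-im = solve 6 (λ a b c d e f →
      a :* (d :+ f) :+ b :* (c :+ e) := (a :* d :+ b :* c) :+ (a :* f :+ b :* e)) refl

    comm-re : ∀ a b c d → a * c + - (b * d) ≈ c * a + - (d * b)
    comm-re a b c d = +-cong (*-comm a c) (-‿cong (*-comm b d))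

    comm-im : ∀ a b c d → a * d + b * c ≈ c * b + d * a
    comm-im a b c d = trans (+-comm (a * d) (b * c)) (+-cong (*-comm b c) (*-comm a d))

    identityˡ-re : ∀ a b → 1# * a + - (0# * b) ≈ a
    identityˡ-re a b = begin
      1# * a + - (0# * b)  ≈⟨ +-cong (*-identityˡ a) (-‿cong (zeroˡ b)) ⟩
      a + - 0#             ≈⟨ +-congˡ -0#≈0# ⟩
      a + 0#               ≈⟨ +-identityʳ a ⟩
      a                    ∎

    identityˡ-im : ∀ a b → 1# * b + 0# * a ≈ b
    identityˡ-im a b = begin
      1# * b + 0# * a  ≈⟨ +-cong (*-identityˡ b) (zeroˡ a) ⟩
      b + 0#           ≈⟨ +-identityʳ b ⟩
      b                ∎

  module R = CommutativeRing ℝ-commutativeRing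
  module RL = ComplexLaws ℝ-commutativeRing

  ≈ℂ-isEquivalence : IsEquivalence _≈ℂ_
  ≈ℂ-isEquivalence = record
    { refl  = R.refl , R.refl
    ; sym   = λ (p , q) → R.sym p , R.sym q
    ; trans = λ (p , q) (r , s) → R.trans p r , R.trans q s
    }

  *ℂ-cong : ∀ {z w u v} → z ≈ℂ w → u ≈ℂ v → z *ℂ u ≈ℂ w *ℂ v
  *ℂ-cong (p , q) (r , s) =
    R.+-cong (R.*-cong p r) (R.-‿cong (R.*-cong q s)) , R.+-cong (R.*-cong p s) (R.*-cong q r)

  *ℂ-assoc : ∀ z w u → (z *ℂ w) *ℂ u ≈ℂ z *ℂ (w *ℂ u)
  *ℂ-assoc (a +i b) (c +i d) (e +i f) = RL.assoc-re a b c d e f , RL.assoc-im a b c d e f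

  *ℂ-comm : ∀ z w → z *ℂ w ≈ℂ w *ℂ z
  *ℂ-comm (a +i b) (c +i d) = RL.comm-re a b c d , RL.comm-im a b c d

  *ℂ-identityˡ : ∀ z → 1ℂ *ℂ z ≈ℂ z
  *ℂ-identityˡ (a +i b) = RL.identityˡ-re a b , RL.identityˡ-im a b

  *ℂ-distribˡ : ∀ z w u → z *ℂ (w +ℂ u) ≈ℂ z *ℂ w +ℂ z *ℂ u
  *ℂ-distribˡ (a +i b) (c +i d) (e +i f) =
    RL.distribˡ-re a b c d e f , RL.distribˡ-im a b c d e f

  module ≈ℂ = IsEquivalence ≈ℂ-isEquivalence

  +ℂ-cong : ∀ {z w u v} → z ≈ℂ w → u ≈ℂ v → z +ℂ u ≈ℂ w +ℂ v
  +ℂ-cong (p , q) (r , s) = R.+-cong p r , R.+-cong q s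

  *ℂ-identityʳ : ∀ z → z *ℂ 1ℂ ≈ℂ z
  *ℂ-identityʳ z = ≈ℂ.trans (*ℂ-comm z 1ℂ) (*ℂ-identityˡ z)

  *ℂ-distribʳ : ∀ z w u → (w +ℂ u) *ℂ z ≈ℂ w *ℂ z +ℂ u *ℂ z
  *ℂ-distribʳ z w u = ≈ℂ.trans (*ℂ-comm (w +ℂ u) z)
    (≈ℂ.trans (*ℂ-distribˡ z w u) (+ℂ-cong (*ℂ-comm z w) (*ℂ-comm z u)))

ℂ-commutativeRing : CommutativeRing 0ℓ 0ℓ
ℂ-commutativeRing = record
  { Carrier = ℂ
  ; _≈_     = _≈ℂ_
  ; _+_     = _+ℂ_
  ; _*_     = _*ℂ_
  ; -_      = -ℂ_
  ; 0#      = 0ℂ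
  ; 1#      = 1ℂ
  ; isCommutativeRing = record
    { isRing = record
      { +-isAbelianGroup = record
        { isGroup = record
          { isMonoid = record
            { isSemigroup = record
              { isMagma = record { isEquivalence = ≈ℂ-isEquivalence ; ∙-cong = +ℂ-cong }
              ; assoc = λ z w u → R.+-assoc (re z) (re w) (re u) , R.+-assoc (im z) (im w) (im u)
              }
            ; identity = (λ z → R.+-identityˡ (re z) , R.+-identityˡ (im z))
                       , (λ z → R.+-identityʳ (re z) , R.+-identityʳ (im z))
            }
          ; inverse = (λ z → R.-‿inverseˡ (re z) , R.-‿inverseˡ (im z))
                    , (λ z → R.-‿inverseʳ (re z) , R.-‿inverseʳ (im z))
          ; ⁻¹-cong = λ (p , q) → R.-‿cong p , R.-‿cong q
          }
        ; comm = λ z w → R.+-comm (re z) (re w) , R.+-comm (im z) (im w)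
        }
      ; *-cong     = *ℂ-cong
      ; *-assoc    = *ℂ-assoc
      ; *-identity = *ℂ-identityˡ , *ℂ-identityʳ
      ; distrib    = *ℂ-distribˡ , *ℂ-distribʳ
      }
    ; *-comm = *ℂ-comm
    }
  }

-- A unital associative K-algebra, given as a ring with a structure map
-- k ↦ k · 1 from K into its center.
record Algebra (K : CommutativeRing c ℓ) a ℓa : Set (c ⊔ ℓ ⊔ lsuc (a ⊔ ℓa)) where
  private module K = CommutativeRing K
  field
    ring : Ring a ℓa
  open Ring ring public
  open RingMorphisms K.rawRing rawRing
  field
    algebraMap         : K.Carrier → Carrier
    isRingHomomorphism : IsRingHomomorphism algebraMap
    algebraMap-central : ∀ k x → algebraMap k * x ≈ x * algebraMap k
  open IsRingHomomorphism isRingHomomorphism public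
    using (⟦⟧-cong; +-homo; *-homo; 0#-homo; 1#-homo; -‿homo)

module _ {K : CommutativeRing c ℓ} (A : Algebra K a ℓa) where
  private module K = CommutativeRing K
  open Algebra A
  open RingProperties ring using (-‿distribˡ-*; -‿distribʳ-*)
  open SetoidReasoning setoid

  IsCentral : Carrier → Set (a ⊔ ℓa)
  IsCentral z = ∀ x → z * x ≈ x * z

  private
    +-central : ∀ {z w} → IsCentral z → IsCentral w → IsCentral (z + w)
    +-central {z} {w} cz cw x = begin
      (z + w) * x    ≈⟨ distribʳ x z w ⟩
      z * x + w * x  ≈⟨ +-cong (cz x) (cw x) ⟩
      x * z + x * w  ≈⟨ distribˡ x z w ⟨
      x * (z + w)    ∎

    *-central : ∀ {z w} → IsCentral z → IsCentral w → IsCentral (z * w)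
    *-central {z} {w} cz cw x = begin
      (z * w) * x  ≈⟨ *-assoc z w x ⟩
      z * (w * x)  ≈⟨ *-congˡ (cw x) ⟩
      z * (x * w)  ≈⟨ *-assoc z x w ⟨
      (z * x) * w  ≈⟨ *-congʳ (cz x) ⟩
      (x * z) * w  ≈⟨ *-assoc x z w ⟩
      x * (z * w)  ∎

    -‿central : ∀ {z} → IsCentral z → IsCentral (- z)
    -‿central {z} cz x = begin
      - z * x    ≈⟨ -‿distribˡ-* z x ⟨
      - (z * x)  ≈⟨ -‿cong (cz x) ⟩
      - (x * z)  ≈⟨ -‿distribʳ-* x z ⟩
      x * - z    ∎

    0#-central : IsCentral 0#
    0#-central x = trans (zeroˡ x) (sym (zeroʳ x))

  Center : Set (a ⊔ ℓa)
  Center = Σ Carrier IsCentral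

  private
    _≈ᶻ_ : Rel Center ℓa
    z ≈ᶻ w = proj₁ z ≈ proj₁ w

    _+ᶻ_ : Center → Center → Center
    (z , cz) +ᶻ (w , cw) = z + w , +-central cz cw

    -ᶻ_ : Center → Center
    -ᶻ (z , cz) = - z , -‿central cz

    0ᶻ : Center
    0ᶻ = 0# , 0#-central

    _·ᶻ_ : K.Carrier → Center → Center
    k ·ᶻ (z , cz) = algebraMap k * z , *-central (algebraMap-central k) cz

    isLeftModule : IsLeftModule K.ring _≈ᶻ_ _+ᶻ_ 0ᶻ -ᶻ_ _·ᶻ_
    isLeftModule = record
      { isLeftSemimodule = record
        { +ᴹ-isCommutativeMonoid = record
          { isMonoid = record
            { isSemigroup = record
              { isMagma = record
                { isEquivalence = record { refl = refl ; sym = sym ; trans = trans }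
                ; ∙-cong = +-cong
                }
              ; assoc = λ (x , _) (y , _) (z , _) → +-assoc x y z
              }
            ; identity = (λ (x , _) → +-identityˡ x) , (λ (x , _) → +-identityʳ x)
            }
          ; comm = λ (x , _) (y , _) → +-comm x y
          }
        ; isPreleftSemimodule = record
          { *ₗ-cong      = λ k≈l x≈y → *-cong (⟦⟧-cong k≈l) x≈y
          ; *ₗ-zeroˡ     = λ (x , _) → trans (*-congʳ 0#-homo) (zeroˡ x)
          ; *ₗ-distribʳ  = λ (x , _) k l →
              trans (*-congʳ (+-homo k l)) (distribʳ x (algebraMap k) (algebraMap l))
          ; *ₗ-identityˡ = λ (x , _) → trans (*-congʳ 1#-homo) (*-identityˡ x)
          ; *ₗ-assoc     = λ k l (x , _) →
              trans (*-congʳ (*-homo k l)) (*-assoc (algebraMap k) (algebraMap l) x)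
          ; *ₗ-zeroʳ     = λ k → zeroʳ (algebraMap k)
          ; *ₗ-distribˡ  = λ k (x , _) (y , _) → distribˡ (algebraMap k) x y
          }
        }
      ; -ᴹ‿cong    = -‿cong
      ; -ᴹ‿inverse = (λ (x , _) → -‿inverseˡ x) , (λ (x , _) → -‿inverseʳ x)
      }

  centerModule : Module K (a ⊔ ℓa) ℓa
  centerModule = record
    { Carrierᴹ = Center
    ; _≈ᴹ_     = _≈ᶻ_
    ; _+ᴹ_     = _+ᶻ_
    ; _*ₗ_     = _·ᶻ_
    ; _*ᵣ_     = λ z k → k ·ᶻ z
    ; 0ᴹ       = 0ᶻ
    ; -ᴹ_      = -ᶻ_
    ; isModule = IsModuleFromLeft.isModule {commutativeRing = K}
                   (record { isLeftModule = isLeftModule })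
    }

module _ {K : CommutativeRing c ℓ} (M : Module K a ℓa) where
  private module K = CommutativeRing K
  open Module M
  open RawMonoidDefinitions +ᴹ-rawMonoid using (sum)

  linearCombination : ∀ {d} → Vector K.Carrier d → Vector Carrierᴹ d → Carrierᴹ
  linearCombination k b = sum (λ i → k i *ₗ b i)

  Spans : ∀ {d} → Vector Carrierᴹ d → Set _
  Spans {d} b = ∀ x → ∃ λ (k : Vector K.Carrier d) → x ≈ᴹ linearCombination k b

  LinearlyIndependent : ∀ {d} → Vector Carrierᴹ d → Set _
  LinearlyIndependent {d} b = ∀ (k : Vector K.Carrier d) →
    linearCombination k b ≈ᴹ 0ᴹ → ∀ i → k i K.≈ K.0#

  HasDimension : ℕ → Set _
  HasDimension d = ∃ λ (b : Vector Carrierᴹ d) → Spans b × LinearlyIndependent b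

record Graph (n : ℕ) : Set₁ where
  field
    Adjacent  : Rel (Fin n) 0ℓ
    adjacent? : Decidable Adjacent
    symmetric : Symmetric Adjacent
    loopless  : Irreflexive _≡_ Adjacent

-- The K-algebra presented by generators and relations: formal expressions
-- in the generators e i, modulo the least congruence containing the axioms
-- of unital associative K-algebras and the defining relations (square,
-- anticommute, commute).

module CliffordPresentation (K : CommutativeRing c ℓ) {n : ℕ} (G : Graph n) where
  private module K = CommutativeRing K
  open Graph G

  infixl 6 _+_
  infixl 7 _*_
  infix  8 -_
  infix  4 _≈_

  data Expr : Set c where
    scalar : K.Carrier → Expr
    e      : Fin n → Expr
    _+_    : Expr → Expr → Expr
    _*_    : Expr → Expr → Expr
    -_     : Expr → Expr

  data _≈_ : Rel Expr (c ⊔ ℓ) where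
    refl  : ∀ {x} → x ≈ x
    sym   : ∀ {x y} → x ≈ y → y ≈ x
    trans : ∀ {x y z} → x ≈ y → y ≈ z → x ≈ z

    +-cong : ∀ {x y u v} → x ≈ y → u ≈ v → x + u ≈ y + v
    *-cong : ∀ {x y u v} → x ≈ y → u ≈ v → x * u ≈ y * v
    -‿cong : ∀ {x y} → x ≈ y → - x ≈ - y

    +-assoc     : ∀ x y z → (x + y) + z ≈ x + (y + z)
    +-comm      : ∀ x y → x + y ≈ y + x
    +-identityˡ : ∀ x → scalar K.0# + x ≈ x
    -‿inverseˡ  : ∀ x → - x + x ≈ scalar K.0#
    *-assoc     : ∀ x y z → (x * y) * z ≈ x * (y * z)
    *-identityˡ : ∀ x → scalar K.1# * x ≈ x
    *-identityʳ : ∀ x → x * scalar K.1# ≈ x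
    distribˡ    : ∀ x y z → x * (y + z) ≈ x * y + x * z
    distribʳ    : ∀ x y z → (y + z) * x ≈ y * x + z * x

    scalar-cong    : ∀ {k l} → k K.≈ l → scalar k ≈ scalar l
    scalar-+       : ∀ k l → scalar (k K.+ l) ≈ scalar k + scalar l
    scalar-*       : ∀ k l → scalar (k K.* l) ≈ scalar k * scalar l
    scalar-central : ∀ k x → scalar k * x ≈ x * scalar k

    square      : ∀ i → e i * e i ≈ - scalar K.1#
    anticommute : ∀ {i j} → ¬ (i ≡ j) → Adjacent i j → e i * e j ≈ - (e j * e i)
    commute     : ∀ {i j} → ¬ (i ≡ j) → ¬ Adjacent i j → e i * e j ≈ e j * e i

  private
    isRing : IsRing _≈_ _+_ _*_ -_ (scalar K.0#) (scalar K.1#)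
    isRing = record
      { +-isAbelianGroup = record
        { isGroup = record
          { isMonoid = record
            { isSemigroup = record
              { isMagma = record
                { isEquivalence = record { refl = refl ; sym = sym ; trans = trans }
                ; ∙-cong = +-cong
                }
              ; assoc = +-assoc
              }
            ; identity = +-identityˡ
                       , λ x → trans (+-comm x (scalar K.0#)) (+-identityˡ x)
            }
          ; inverse = -‿inverseˡ , λ x → trans (+-comm x (- x)) (-‿inverseˡ x)
          ; ⁻¹-cong = -‿cong
          }
        ; comm = +-comm
        }
      ; *-cong     = *-cong
      ; *-assoc    = *-assoc
      ; *-identity = *-identityˡ , *-identityʳ
      ; distrib    = distribˡ , distribʳ
      }

    ring : Ring c (c ⊔ ℓ)
    ring = record { isRing = isRing }

    scalar-- : ∀ k → scalar (K.- k) ≈ - scalar k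
    scalar-- k = inverseˡ-unique (scalar (K.- k)) (scalar k)
      (trans (sym (scalar-+ (K.- k) k)) (scalar-cong (K.-‿inverseˡ k)))
      where open GroupProperties (Ring.+-group ring) using (inverseˡ-unique)

  algebra : Algebra K c (c ⊔ ℓ)
  algebra = record
    { ring       = ring
    ; algebraMap = scalar
    ; isRingHomomorphism = record
      { isSemiringHomomorphism = record
        { isNearSemiringHomomorphism = record
          { +-isMonoidHomomorphism = record
            { isMagmaHomomorphism = record
              { isRelHomomorphism = record { cong = scalar-cong }
              ; homo = scalar-+
              }
            ; ε-homo = refl
            }
          ; *-homo = scalar-*
          }
        ; 1#-homo = refl
        }
      ; -‿homo = scalar--
      }
    ; algebraMap-central = scalar-central
    }

cliffordGraphAlgebra : ∀ {n} → Graph n → Algebra ℂ-commutativeRing 0ℓ 0ℓ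
cliffordGraphAlgebra G = CliffordPresentation.algebra ℂ-commutativeRing G

Matrix : ℕ → Set
Matrix n = Fin n → Fin n → ℤ

adjacencyMatrix : ∀ {n} → Graph n → Matrix n
adjacencyMatrix G i j = if does (Graph.adjacent? G i j) then 1ℤ else 0ℤ

-- Laplace expansion along the first row.
det : ∀ {n} → Matrix n → ℤ
det {zero}  M = 1ℤ
det {suc n} M =
  sum (λ j → -1ℤ ℤ.^ toℕ j ℤ.* (M zero j ℤ.* det (λ i k → M (suc i) (punchIn j k))))
  where open RawMonoidDefinitions ℤ.+-0-rawMonoid using (sum)

Odd : ℤ → Set
Odd d = ∃ λ k → d ≡ (ℤ.+ 2) ℤ.* k ℤ.+ 1ℤ

{-# OPTIONS --safe #-}

-- Over 𝔽₂ the Laplace expansion is alternating in the rows, so the determinant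
-- of the adjacency matrix a is odd iff a has trivial kernel modulo 2.  The
-- generator e i commutes with the monomial e_S up to the sign (-1)^(a S)_i, so
-- e_S is central iff S lies in this kernel.  If the kernel is trivial,
-- averaging a central element over conjugation by all the e i kills every
-- monomial but 1, hence the element is a scalar.  If S ≠ 0 lies in the kernel,
-- then 1 and e_S are both central; they are not proportional, because e_S is
-- invertible and the regular representation shows its constant term to vanish.
module Submission where

import Algebra.Definitions.RawMonoid as RawMonoidDefinitions
open import Algebra.Bundles using (Ring; CommutativeRing)
import Algebra.Properties.CommutativeSemigroup as CommutativeSemigroupProperties
import Algebra.Properties.Ring as RingProperties
import Algebra.Properties.Semiring.Sum as SemiringSum
open import Data.Bool.Base using (Bool; true; false; not; _∧_; _xor_; if_then_else_)
open import Data.Bool.Properties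
  using (xor-∧-commutativeRing; xor-assoc; xor-same; xor-identityʳ; ∧-comm; ∧-assoc; ∧-zeroʳ;
         ∧-identityʳ; ∧-distribˡ-xor; not-involutive; ¬-not)
  renaming (_≟_ to _≟ᵇ_)
import Data.Bool.Solver as Bool
open import Data.Fin.Base using (Fin; zero; suc; punchIn; punchOut; toℕ)
open import Data.Fin.Properties
  using (_≟_; <-cmp; any?; punchInᵢ≢i; punchOut-punchIn; punchOut-cong)
open import Data.Integer.Base as ℤ using (ℤ; 0ℤ; 1ℤ; -1ℤ)
import Data.Integer.Properties as ℤ
import Data.Integer.Solver as ℤ
open import Data.List.Base using (List; []; _∷_; allFin)
open import Data.List.Membership.Propositional.Properties using (∈-allFin)
open import Data.List.Relation.Unary.All as All using (All; []; _∷_)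
open import Data.Nat.Base as ℕ using (ℕ; zero; suc; NonZero)
import Data.Nat.Properties as ℕ
open import Data.Product.Base using (∃; _×_; _,_; proj₁; proj₂)
open import Data.Rational.Base using (½; 1ℚ)
import Data.Rational.Properties as ℚ
open import Data.Unit.Base using (⊤; tt)
open import Data.Vec.Base using (Vec; []; _∷_; lookup; replicate; tabulate; updateAt)
open import Data.Vec.Functional as Vector using (Vector; insertAt)
open import Data.Vec.Functional.Properties using (insertAt-lookup; insertAt-punchIn)
open import Data.Vec.Properties
  using (lookup-replicate; lookup∘tabulate; lookup∘updateAt; lookup∘updateAt′;
         updateAt-commutes; updateAt-updateAt; updateAt-id-local)
open import Function.Base using (_∘_; id)
open import Function.Bundles using (_⇔_; mk⇔)
open import Level using (Level; _⊔_; 0ℓ)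
open import Relation.Binary.Definitions using (tri<; tri≈; tri>)
open import Relation.Binary.PropositionalEquality as ≡ using (_≡_; _≢_; _≗_)
import Relation.Binary.Reasoning.Setoid as SetoidReasoning
open import Relation.Nullary.Decidable using (yes; no; does)
open import Relation.Nullary.Negation using (¬_; contradiction)
open import Relation.Unary using (Pred)
open import Defs

private variable
  c ℓ : Level
  m n : ℕ

-- Linear algebra over 𝔽₂, with `xor` as addition and `∧` as multiplication.

module BinaryLinearAlgebra where
  open ≡ using (refl; sym; trans; cong; cong₂; module ≡-Reasoning)

  open SemiringSum (CommutativeRing.semiring xor-∧-commutativeRing)
    using (sum; sum-cong-≗; sum-remove; sum-replicate-zero; ∑-comm; ∑-distrib-+; *-distribˡ-sum; *-distribʳ-sum)

  Matrix₂ : ℕ → ℕ → Set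
  Matrix₂ m n = Fin m → Fin n → Bool

  infix 7 _∙_

  _∙_ : ∀ {n} → Vector Bool n → Vector Bool n → Bool
  u ∙ v = sum (λ i → u i ∧ v i)

  ∙-cong : ∀ {n} {u u′ v v′ : Vector Bool n} → u ≗ u′ → v ≗ v′ → u ∙ v ≡ u′ ∙ v′
  ∙-cong u≗u′ v≗v′ = sum-cong-≗ (λ i → cong₂ _∧_ (u≗u′ i) (v≗v′ i))

  ∙-comm : ∀ {n} (u v : Vector Bool n) → u ∙ v ≡ v ∙ u
  ∙-comm u v = sum-cong-≗ (λ i → ∧-comm (u i) (v i))

  sum-false : ∀ {n} {f : Vector Bool n} → (∀ i → f i ≡ false) → sum f ≡ false
  sum-false {n} f≡0 = trans (sum-cong-≗ f≡0) (sum-replicate-zero n)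

  sum-true : ∀ {n} (f : Vector Bool n) → sum f ≡ true → ∃ λ i → f i ≡ true
  sum-true {suc n} f eq with f zero in f₀
  ... | true  = zero , f₀
  ... | false = let i , fi = sum-true (f ∘ suc) eq in suc i , fi

  ∙-distribˡ : ∀ {n} (r u v : Vector Bool n) → r ∙ (λ i → u i xor v i) ≡ r ∙ u xor r ∙ v
  ∙-distribˡ r u v = trans
    (sum-cong-≗ (λ i → ∧-distribˡ-xor (r i) (u i) (v i)))
    (∑-distrib-+ (λ i → r i ∧ u i) (λ i → r i ∧ v i))

  ∙-assoc : ∀ {m n} (v : Vector Bool m) (M : Matrix₂ m n) (w : Vector Bool n) →
            (λ j → v ∙ (λ i → M i j)) ∙ w ≡ v ∙ (λ i → M i ∙ w)
  ∙-assoc {m} {n} v M w = begin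
    sum (λ j → sum (λ i → v i ∧ M i j) ∧ w j)
      ≡⟨ sum-cong-≗ (λ j → *-distribʳ-sum (w j) (λ i → v i ∧ M i j)) ⟩
    sum (λ j → sum (λ i → (v i ∧ M i j) ∧ w j))
      ≡⟨ ∑-comm (λ j i → (v i ∧ M i j) ∧ w j) ⟩
    sum (λ i → sum (λ j → (v i ∧ M i j) ∧ w j))
      ≡⟨ sum-cong-≗ (λ i → sum-cong-≗ (λ j → ∧-assoc (v i) (M i j) (w j))) ⟩
    sum (λ i → sum (λ j → v i ∧ (M i j ∧ w j)))
      ≡⟨ sum-cong-≗ (λ i → *-distribˡ-sum (v i) (λ j → M i j ∧ w j)) ⟨
    sum (λ i → v i ∧ sum (λ j → M i j ∧ w j))
      ∎
    where open ≡-Reasoning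

  -- Determinants over 𝔽₂ and their vanishing on repeated rows.

  minor : ∀ {m n} → Matrix₂ (suc m) (suc n) → Fin (suc n) → Matrix₂ m n
  minor M j i k = M (suc i) (punchIn j k)

  -- There are no signs in characteristic 2.
  det₂ : ∀ {n} → Matrix₂ n n → Bool
  det₂ {zero}  M = true
  det₂ {suc n} M = M zero ∙ (λ j → det₂ (minor M j))

  cofactors : ∀ {n} → Matrix₂ (suc n) (suc n) → Vector Bool (suc n)
  cofactors M j = det₂ (minor M j)

  det₂-cong : ∀ {n} {M N : Matrix₂ n n} → (∀ i j → M i j ≡ N i j) → det₂ M ≡ det₂ N
  det₂-cong {zero}  M≗N = refl
  det₂-cong {suc n} M≗N =
    ∙-cong (M≗N zero) (λ j → det₂-cong (λ i k → M≗N (suc i) (punchIn j k)))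

  -- Both sides enumerate in increasing order the indices other than `j` and `k`, so two columns may
  -- be deleted in either order.
  punchIn-punchOut-comm : ∀ {n} {j k : Fin (suc (suc n))} (j≢k : j ≢ k) (k≢j : k ≢ j) (l : Fin n) →
    punchIn j (punchIn (punchOut j≢k) l) ≡ punchIn k (punchIn (punchOut k≢j) l)
  punchIn-punchOut-comm {_}     {zero}  {zero}  j≢k k≢j l       = contradiction refl j≢k
  punchIn-punchOut-comm {suc n} {zero}  {suc k} j≢k k≢j l       = refl
  punchIn-punchOut-comm {suc n} {suc j} {zero}  j≢k k≢j l       = refl
  punchIn-punchOut-comm {suc n} {suc j} {suc k} j≢k k≢j zero    = refl
  punchIn-punchOut-comm {suc n} {suc j} {suc k} j≢k k≢j (suc l) =
    cong suc (punchIn-punchOut-comm (j≢k ∘ cong suc) (k≢j ∘ cong suc) l)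

  sum-offDiagonal : ∀ {n} (f : Matrix₂ (suc n) (suc n)) → (∀ j → f j j ≡ false) →
    sum (λ j → sum (λ k → f j (punchIn j k))) ≡ sum (λ j → sum (f j))
  sum-offDiagonal f f≡0 = sum-cong-≗ λ j →
    sym (trans (sum-remove {i = j} (f j)) (cong (_xor sum (λ k → f j (punchIn j k))) (f≡0 j)))

  -- In characteristic 2 the entries at `(j , k)` and `(k , j)` cancel. The induction peels off the
  -- first row together with the first column.
  sum-symmetric : ∀ {n} (f : Matrix₂ n n) → (∀ j → f j j ≡ false) → (∀ j k → f j k ≡ f k j) →
    sum (λ j → sum (f j)) ≡ false
  sum-symmetric {zero}  f f≡0 f-sym = refl
  sum-symmetric {suc n} f f≡0 f-sym = begin
    (f zero zero xor row) xor sum (λ j → f (suc j) zero xor sum (f (suc j) ∘ suc))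
      ≡⟨ cong₂ _xor_ (cong (_xor row) (f≡0 zero))
           (∑-distrib-+ (λ j → f (suc j) zero) (λ j → sum (f (suc j) ∘ suc))) ⟩
    row xor (sum (λ j → f (suc j) zero) xor sum (λ j → sum (f (suc j) ∘ suc)))
      ≡⟨ cong (row xor_) (cong₂ _xor_ (sum-cong-≗ (λ j → f-sym (suc j) zero))
           (sum-symmetric (λ j k → f (suc j) (suc k)) (f≡0 ∘ suc) (λ j k → f-sym (suc j) (suc k)))) ⟩
    row xor (row xor false)
      ≡⟨ cong (row xor_) (xor-identityʳ row) ⟩
    row xor row
      ≡⟨ xor-same row ⟩
    false ∎
    where
    open ≡-Reasoning
    row = sum (f zero ∘ suc)

  -- The value at j = k is set to 0, so that sums over j ≠ k become full double sums.
  deleted₂ : ∀ {n} → Matrix₂ n (suc (suc n)) → Matrix₂ (suc (suc n)) (suc (suc n))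
  deleted₂ N j k with j ≟ k
  ... | yes _   = false
  ... | no  j≢k = det₂ (λ i l → N i (punchIn j (punchIn (punchOut j≢k) l)))

  deleted₂-diagonal : ∀ {n} (N : Matrix₂ n (suc (suc n))) j → deleted₂ N j j ≡ false
  deleted₂-diagonal N j with j ≟ j
  ... | yes _   = refl
  ... | no  j≢j = contradiction refl j≢j

  deleted₂-sym : ∀ {n} (N : Matrix₂ n (suc (suc n))) j k → deleted₂ N j k ≡ deleted₂ N k j
  deleted₂-sym N j k with j ≟ k | k ≟ j
  ... | yes _   | yes _   = refl
  ... | yes j≡k | no  k≢j = contradiction (sym j≡k) k≢j
  ... | no  j≢k | yes k≡j = contradiction (sym k≡j) j≢k
  ... | no  j≢k | no  k≢j = det₂-cong (λ i l → cong (N i) (punchIn-punchOut-comm j≢k k≢j l))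

  deleted₂-punchIn : ∀ {n} (N : Matrix₂ n (suc (suc n))) j k →
    deleted₂ N j (punchIn j k) ≡ det₂ (λ i l → N i (punchIn j (punchIn k l)))
  deleted₂-punchIn N j k with j ≟ punchIn j k
  ... | yes eq  = contradiction (sym eq) (punchInᵢ≢i j k)
  ... | no  neq = det₂-cong λ i l →
    cong (λ k′ → N i (punchIn j (punchIn k′ l))) (trans (punchOut-cong j refl) (punchOut-punchIn j))

  module _ {n} (r s : Vector Bool (suc (suc n))) (N : Matrix₂ n (suc (suc n))) where

    expansion₂-term : Matrix₂ (suc (suc n)) (suc (suc n))
    expansion₂-term j k = (r j ∧ s k) ∧ deleted₂ N j k

    expansion₂-term-diagonal : ∀ j → expansion₂-term j j ≡ false
    expansion₂-term-diagonal j =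
      trans (cong ((r j ∧ s j) ∧_) (deleted₂-diagonal N j)) (∧-zeroʳ (r j ∧ s j))

    expansion₂ : Bool
    expansion₂ = sum (λ j → sum (expansion₂-term j))

  -- Laplace expansion along the first two rows, as a sum over ordered pairs of distinct columns.
  -- The complementary minor is symmetric in the pair, so the effect of equating or exchanging the
  -- two rows can be read off termwise.
  det₂-expansion₂ : ∀ {n} (M : Matrix₂ (suc (suc n)) (suc (suc n))) →
    det₂ M ≡ expansion₂ (M zero) (M (suc zero)) (λ i → M (suc (suc i)))
  det₂-expansion₂ {n} M = begin
    sum (λ j → r j ∧ sum (λ k → s (punchIn j k) ∧ D j k))
      ≡⟨ sum-cong-≗ (λ j → *-distribˡ-sum (r j) (λ k → s (punchIn j k) ∧ D j k)) ⟩
    sum (λ j → sum (λ k → r j ∧ (s (punchIn j k) ∧ D j k)))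
      ≡⟨ sum-cong-≗ (λ j → sum-cong-≗ (λ k → ∧-assoc (r j) (s (punchIn j k)) (D j k))) ⟨
    sum (λ j → sum (λ k → (r j ∧ s (punchIn j k)) ∧ D j k))
      ≡⟨ sum-cong-≗ (λ j → sum-cong-≗ (λ k →
           cong ((r j ∧ s (punchIn j k)) ∧_) (deleted₂-punchIn N j k))) ⟨
    sum (λ j → sum (λ k → expansion₂-term r s N j (punchIn j k)))
      ≡⟨ sum-offDiagonal (expansion₂-term r s N) (expansion₂-term-diagonal r s N) ⟩
    expansion₂ r s N ∎
    where
    open ≡-Reasoning
    r = M zero
    s = M (suc zero)
    N = λ i → M (suc (suc i))
    D : Fin (suc (suc n)) → Fin (suc n) → Bool
    D j k = det₂ (λ i l → N i (punchIn j (punchIn k l)))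

  expansion₂-alternating : ∀ {n} r (N : Matrix₂ n (suc (suc n))) → expansion₂ r r N ≡ false
  expansion₂-alternating r N = sum-symmetric (expansion₂-term r r N) (expansion₂-term-diagonal r r N)
    (λ j k → cong₂ _∧_ (∧-comm (r j) (r k)) (deleted₂-sym N j k))

  expansion₂-swap : ∀ {n} r s (N : Matrix₂ n (suc (suc n))) → expansion₂ r s N ≡ expansion₂ s r N
  expansion₂-swap r s N = trans (∑-comm (expansion₂-term r s N))
    (sum-cong-≗ λ j → sum-cong-≗ λ k → cong₂ _∧_ (∧-comm (r k) (s j)) (deleted₂-sym N k j))

  det₂-alternating : ∀ {n} (M : Matrix₂ (suc n) (suc n)) i → M zero ≗ M (suc i) → det₂ M ≡ false
  det₂-alternating {suc n} M zero eq = begin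
    det₂ M             ≡⟨ det₂-expansion₂ M ⟩
    expansion₂ r s N   ≡⟨ sum-cong-≗ (λ j → sum-cong-≗ (λ k →
                            cong (λ x → (r j ∧ x) ∧ deleted₂ N j k) (eq k))) ⟨
    expansion₂ r r N   ≡⟨ expansion₂-alternating r N ⟩
    false              ∎
    where
    open ≡-Reasoning
    r = M zero
    s = M (suc zero)
    N = λ i → M (suc (suc i))
  -- Exchanging the first two rows moves the first row into every minor.
  det₂-alternating {suc n} M (suc i) eq = begin
    det₂ M             ≡⟨ det₂-expansion₂ M ⟩
    expansion₂ r s N   ≡⟨ expansion₂-swap r s N ⟩
    expansion₂ s r N   ≡⟨ det₂-expansion₂ M′ ⟨
    det₂ M′            ≡⟨ sum-false (λ j → trans
                            (cong (s j ∧_) (det₂-alternating (minor M′ j) i (eq ∘ punchIn j)))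
                            (∧-zeroʳ (s j))) ⟩
    false              ∎
    where
    open ≡-Reasoning
    r = M zero
    s = M (suc zero)
    N = λ i → M (suc (suc i))
    M′ = s Vector.∷ r Vector.∷ N

  -- The product is the determinant of `M` with its first row replaced by row `suc i`, a matrix with
  -- a repeated row.
  cofactors-orthogonal : ∀ {n} (M : Matrix₂ (suc n) (suc n)) i → M (suc i) ∙ cofactors M ≡ false
  cofactors-orthogonal M i = det₂-alternating (M (suc i) Vector.∷ (M ∘ suc)) i (λ _ → refl)

  -- Determinant and kernel over 𝔽₂.

  ∧-true⇒ʳ : ∀ x {y} → x ∧ y ≡ true → y ≡ true
  ∧-true⇒ʳ true eq = eq

  -- Multiplying a left kernel vector with M · cofactors M = (det₂ M, 0, …, 0)
  -- annihilates its first entry.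
  det₂-true⇒leftKernel-trivial : ∀ {n} (M : Matrix₂ n n) → det₂ M ≡ true →
    ∀ v → (∀ j → v ∙ (λ i → M i j) ≡ false) → ∀ i → v i ≡ false
  det₂-true⇒leftKernel-trivial {suc n} M detM v vM≡0 = λ where
      zero    → v₀≡0
      (suc i) → det₂-true⇒leftKernel-trivial (minor M j) (∧-true⇒ʳ (M zero j) Mw)
                  (v ∘ suc) v′M′≡0 i
    where
    open ≡-Reasoning
    w = cofactors M
    v₀≡0 : v zero ≡ false
    v₀≡0 = begin
      v zero
        ≡⟨ xor-identityʳ (v zero) ⟨
      v zero xor false
        ≡⟨ cong₂ _xor_ (trans (cong (v zero ∧_) detM) (∧-identityʳ (v zero)))
             (sum-false (λ i → trans
               (cong (v (suc i) ∧_) (cofactors-orthogonal M i)) (∧-zeroʳ (v (suc i))))) ⟨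
      v ∙ (λ i → M i ∙ w)
        ≡⟨ ∙-assoc v M w ⟨
      (λ j → v ∙ (λ i → M i j)) ∙ w
        ≡⟨ sum-false (λ j → cong (_∧ w j) (vM≡0 j)) ⟩
      false ∎
    -- A nonzero determinant has a nonzero term in its expansion, hence a nonzero minor. Since
    -- `v zero` vanishes, the tail of `v` lies in the left kernel of that minor, and the induction
    -- continues there.
    nonzeroTerm = sum-true (λ j → M zero j ∧ w j) detM
    j  = proj₁ nonzeroTerm
    Mw = proj₂ nonzeroTerm
    v′M′≡0 : ∀ k → (v ∘ suc) ∙ (λ i → minor M j i k) ≡ false
    v′M′≡0 k = trans
      (cong (λ b → (b ∧ M zero (punchIn j k)) xor (v ∘ suc) ∙ (λ i → minor M j i k)) (sym v₀≡0))
      (vM≡0 (punchIn j k))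

  -- Turns a kernel vector of the minor without column `p`, extended by zero at `p`, into a vector
  -- killed by every row but the first.
  insertAt-∙ : ∀ {n} (r : Vector Bool (suc n)) (v : Vector Bool n) p →
               r ∙ insertAt v p false ≡ (r ∘ punchIn p) ∙ v
  insertAt-∙ r v p = trans (sum-remove {i = p} (λ k → r k ∧ insertAt v p false k))
    (cong₂ _xor_
      (trans (cong (r p ∧_) (insertAt-lookup v p false)) (∧-zeroʳ (r p)))
      (sum-cong-≗ (λ k → cong (r (punchIn p k) ∧_) (insertAt-punchIn v p false k))))

  NontrivialKernel : ∀ {m n} → Matrix₂ m n → Set
  NontrivialKernel M = ∃ λ v → (∃ λ i → v i ≡ true) × (∀ i → M i ∙ v ≡ false)

  -- Of two distinct nonzero vectors u, u′ killed by all rows but the first, one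
  -- of u, u′, u + u′ is killed by the first row as well.
  distinctSolutions⇒kernel : ∀ {m n} (M : Matrix₂ (suc m) n) u u′ i i′ →
    u i ≡ true → u′ i ≡ false → u′ i′ ≡ true →
    (∀ k → M (suc k) ∙ u ≡ false) → (∀ k → M (suc k) ∙ u′ ≡ false) → NontrivialKernel M
  distinctSolutions⇒kernel M u u′ i i′ ui u′i u′i′ Mu Mu′ with M zero ∙ u in eq | M zero ∙ u′ in eq′
  ... | false | _     = u  , (i , ui)     , λ { zero → eq  ; (suc k) → Mu k }
  ... | true  | false = u′ , (i′ , u′i′) , λ { zero → eq′ ; (suc k) → Mu′ k }
  ... | true  | true  = (λ j → u j xor u′ j) , (i , cong₂ _xor_ ui u′i) , λ where
    zero    → trans (∙-distribˡ (M zero) u u′) (cong₂ _xor_ eq eq′)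
    (suc k) → trans (∙-distribˡ (M (suc k)) u u′) (cong₂ _xor_ (Mu k) (Mu′ k))

  -- A nonzero cofactor vector is itself a kernel vector. If it is zero, all these minors are
  -- singular: one without column 0 gives a vector with a nonzero entry at some `suc i`, and the one
  -- without column `suc i` gives a vector that is zero there, so the two are distinct.
  det₂-false⇒kernel : ∀ {n} (M : Matrix₂ n n) → det₂ M ≡ false → NontrivialKernel M
  det₂-false⇒kernel {suc n} M detM with any? (λ j → cofactors M j ≟ᵇ true)
  ... | yes (j , wj) = cofactors M , (j , wj) , λ where
    zero    → detM
    (suc i) → cofactors-orthogonal M i
  ... | no  w≡0 =
    let kernel p = det₂-false⇒kernel (minor M p) (¬-not (λ wp → w≡0 (p , wp)))
        u , (i , ui) , Mu = kernel zero
        u′ , (i′ , u′i′) , Mu′ = kernel (suc i)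
    in distinctSolutions⇒kernel M (insertAt u zero false) (insertAt u′ (suc i) false)
         (suc i) (punchIn (suc i) i′)
         (trans (insertAt-punchIn u zero false i) ui)
         (insertAt-lookup u′ (suc i) false)
         (trans (insertAt-punchIn u′ (suc i) false i′) u′i′)
         (λ k → trans (insertAt-∙ (M (suc k)) u zero) (Mu k))
         (λ k → trans (insertAt-∙ (M (suc k)) u′ (suc i)) (Mu′ k))

  -- Reduction of integers and their determinants modulo 2.

  bit : Bool → ℤ
  bit b = if b then 1ℤ else 0ℤ

  infix 4 _≡₂_

  -- Shaped so that `d ≡₂ true` unfolds to `Odd d`.
  _≡₂_ : ℤ → Bool → Set
  d ≡₂ b = ∃ λ k → d ≡ ℤ.+ 2 ℤ.* k ℤ.+ bit b

  open ℤ.+-*-Solver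

  ≡₂-bit : ∀ b → bit b ≡₂ b
  ≡₂-bit b = 0ℤ , sym (ℤ.+-identityˡ (bit b))

  ≡₂-+ : ∀ {d e} b c → d ≡₂ b → e ≡₂ c → d ℤ.+ e ≡₂ b xor c
  ≡₂-+ false c (k , refl) (l , refl) = k ℤ.+ l ,
    solve 3 (λ k l c →
      (con (ℤ.+ 2) :* k :+ con 0ℤ) :+ (con (ℤ.+ 2) :* l :+ c) :=
      con (ℤ.+ 2) :* (k :+ l) :+ c) refl k l (bit c)
  ≡₂-+ true false (k , refl) (l , refl) = k ℤ.+ l ,
    solve 2 (λ k l →
      (con (ℤ.+ 2) :* k :+ con 1ℤ) :+ (con (ℤ.+ 2) :* l :+ con 0ℤ) :=
      con (ℤ.+ 2) :* (k :+ l) :+ con 1ℤ) refl k l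
  ≡₂-+ true true (k , refl) (l , refl) = k ℤ.+ l ℤ.+ 1ℤ ,
    solve 2 (λ k l →
      (con (ℤ.+ 2) :* k :+ con 1ℤ) :+ (con (ℤ.+ 2) :* l :+ con 1ℤ) :=
      con (ℤ.+ 2) :* (k :+ l :+ con 1ℤ) :+ con 0ℤ) refl k l

  ≡₂-* : ∀ {d e} b c → d ≡₂ b → e ≡₂ c → d ℤ.* e ≡₂ b ∧ c
  ≡₂-* false c (k , refl) (l , refl) = k ℤ.* (ℤ.+ 2 ℤ.* l ℤ.+ bit c) ,
    solve 3 (λ k l c →
      (con (ℤ.+ 2) :* k :+ con 0ℤ) :* (con (ℤ.+ 2) :* l :+ c) :=
      con (ℤ.+ 2) :* (k :* (con (ℤ.+ 2) :* l :+ c)) :+ con 0ℤ) refl k l (bit c)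
  ≡₂-* true c (k , refl) (l , refl) = k ℤ.* (ℤ.+ 2 ℤ.* l ℤ.+ bit c) ℤ.+ l ,
    solve 3 (λ k l c →
      (con (ℤ.+ 2) :* k :+ con 1ℤ) :* (con (ℤ.+ 2) :* l :+ c) :=
      con (ℤ.+ 2) :* (k :* (con (ℤ.+ 2) :* l :+ c) :+ l) :+ c) refl k l (bit c)

  ≡₂-sign : ∀ k → -1ℤ ℤ.^ k ≡₂ true
  ≡₂-sign zero    = ≡₂-bit true
  -- The witness comes from -1 = 2 · (-1) + 1.
  ≡₂-sign (suc k) = ≡₂-* true true (-1ℤ , refl) (≡₂-sign k)

  open RawMonoidDefinitions ℤ.+-0-rawMonoid using () renaming (sum to sumℤ)

  ≡₂-sum : ∀ {n} {f : Vector ℤ n} {g : Vector Bool n} → (∀ i → f i ≡₂ g i) → sumℤ f ≡₂ sum g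
  ≡₂-sum {zero}  f≡₂g = ≡₂-bit false
  ≡₂-sum {suc n} {g = g} f≡₂g = ≡₂-+ (g zero) (sum (g ∘ suc)) (f≡₂g zero) (≡₂-sum (f≡₂g ∘ suc))

  -- Laplace expansion uses only sums and products, which reduce modulo 2, and its signs are all
  -- odd.
  det-≡₂ : ∀ {n} {M : Matrix n} {N : Matrix₂ n n} → (∀ i j → M i j ≡₂ N i j) → det M ≡₂ det₂ N
  det-≡₂ {zero}  M≡₂N = ≡₂-bit true
  det-≡₂ {suc n} {N = N} M≡₂N = ≡₂-sum λ j →
    ≡₂-* true (N zero j ∧ det₂ (minor N j)) (≡₂-sign (toℕ j))
      (≡₂-* (N zero j) (det₂ (minor N j)) (M≡₂N zero j)
        (det-≡₂ (λ i k → M≡₂N (suc i) (punchIn j k))))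

  -- Equality would give 2(k - l) = 1; absolute values carry this to the natural numbers.
  even≢odd : ∀ k l → ℤ.+ 2 ℤ.* k ℤ.+ 0ℤ ≢ ℤ.+ 2 ℤ.* l ℤ.+ 1ℤ
  even≢odd k l eq = ℕ.even≢odd ℤ.∣ k ℤ.- l ∣ 0 (begin
    2 ℕ.* ℤ.∣ k ℤ.- l ∣            ≡⟨ ℤ.abs-* (ℤ.+ 2) (k ℤ.- l) ⟨
    ℤ.∣ ℤ.+ 2 ℤ.* (k ℤ.- l) ∣      ≡⟨ cong ℤ.∣_∣ (solve 2 (λ k l →
                                        con (ℤ.+ 2) :* (k :- l) :=
                                        (con (ℤ.+ 2) :* k :+ con 0ℤ) :- con (ℤ.+ 2) :* l) refl k l) ⟩
    ℤ.∣ ℤ.+ 2 ℤ.* k ℤ.+ 0ℤ ℤ.- ℤ.+ 2 ℤ.* l ∣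
                                   ≡⟨ cong (λ d → ℤ.∣ d ℤ.- ℤ.+ 2 ℤ.* l ∣) eq ⟩
    ℤ.∣ ℤ.+ 2 ℤ.* l ℤ.+ 1ℤ ℤ.- ℤ.+ 2 ℤ.* l ∣
                                   ≡⟨ cong ℤ.∣_∣ (solve 1 (λ l →
                                        (con (ℤ.+ 2) :* l :+ con 1ℤ) :- con (ℤ.+ 2) :* l := con 1ℤ) refl l) ⟩
    1 ∎)
    where open ≡-Reasoning

  ≡₂-odd : ∀ {d} b → d ≡₂ b → Odd d → b ≡ true
  ≡₂-odd true  _        _       = refl
  ≡₂-odd false (k , eq) (l , eq′) = contradiction (trans (sym eq) eq′) (even≢odd k l)

-- Words, encoding the sets of vertices that index monomials.

open BinaryLinearAlgebra

-- Inductive vectors, unlike functions, make identities between flipped words propositional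
-- equalities, along which functions of words can be rewritten.
Word : ℕ → Set
Word = Vec Bool

flip : Fin n → Word n → Word n
flip i S = updateAt S i not

-- Flipping an entry adds the corresponding unit vector.
∙-flip : (r : Vector Bool n) (j : Fin n) (S : Word n) →
         r ∙ lookup (flip j S) ≡ r j xor r ∙ lookup S
∙-flip r zero    (b ∷ S) = lemma (r zero) b _
  where
  lemma : ∀ x b y → (x ∧ not b) xor y ≡ x xor ((x ∧ b) xor y)
  lemma true  true  y = ≡.sym (not-involutive y)
  lemma true  false y = ≡.refl
  lemma false b     y = ≡.refl
∙-flip r (suc j) (b ∷ S) = ≡.trans (≡.cong ((r zero ∧ b) xor_) (∙-flip (r ∘ suc) j S))
  (solve 3 (λ x y z → x :+ (y :+ z) := y :+ (x :+ z)) ≡.refl (r zero ∧ b) (r (suc j)) _)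
  where open Bool.xor-∧-Solver

indicator-∙ : (i : Fin n) (v : Vector Bool n) → (λ j → does (i ≟ j)) ∙ v ≡ v i
indicator-∙ zero    v = ≡.trans
  (≡.cong (v zero xor_)
    (sum-false {f = λ j → does (zero ≟ suc j) ∧ v (suc j)} (λ _ → ≡.refl)))
  (xor-identityʳ (v zero))
indicator-∙ (suc i) v = indicator-∙ i (v ∘ suc)

-- Signs, and commutation up to sign, in an arbitrary ring.

module Sign (R : Ring c ℓ) where
  open Ring R
  open RingProperties R using (-‿distribˡ-*; -‿distribʳ-*; -‿involutive; -‿+-comm; -0#≈0#)

  signed : Bool → Carrier → Carrier
  signed b x = if b then - x else x

  signed-cong : ∀ b {x y} → x ≈ y → signed b x ≈ signed b y
  signed-cong true  = -‿cong
  signed-cong false = id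

  signed-xor : ∀ b c x → signed b (signed c x) ≈ signed (b xor c) x
  signed-xor true  true  x = -‿involutive x
  signed-xor true  false x = refl
  signed-xor false c     x = refl

  signed-*ˡ : ∀ b x y → signed b x * y ≈ signed b (x * y)
  signed-*ˡ true  x y = sym (-‿distribˡ-* x y)
  signed-*ˡ false x y = refl

  signed-*ʳ : ∀ b x y → x * signed b y ≈ signed b (x * y)
  signed-*ʳ true  x y = sym (-‿distribʳ-* x y)
  signed-*ʳ false x y = refl

  signed-+ : ∀ b x y → signed b (x + y) ≈ signed b x + signed b y
  signed-+ true  x y = sym (-‿+-comm x y)
  signed-+ false x y = refl

  signed-0 : ∀ b {x} → x ≈ 0# → signed b x ≈ 0#
  signed-0 true  x≈0 = trans (-‿cong x≈0) -0#≈0#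
  signed-0 false x≈0 = x≈0

  infix 4 _⇄[_]_

  _⇄[_]_ : Carrier → Bool → Carrier → Set _
  x ⇄[ b ] y = x * y ≈ signed b (y * x)

  open SetoidReasoning setoid

  ⇄-* : ∀ {x y z b c} → x ⇄[ b ] y → x ⇄[ c ] z → x ⇄[ b xor c ] y * z
  ⇄-* {x} {y} {z} {b} {c} x⇄y x⇄z = begin
    x * (y * z)                    ≈⟨ *-assoc x y z ⟨
    x * y * z                      ≈⟨ *-congʳ x⇄y ⟩
    signed b (y * x) * z           ≈⟨ signed-*ˡ b (y * x) z ⟩
    signed b (y * x * z)           ≈⟨ signed-cong b (*-assoc y x z) ⟩
    signed b (y * (x * z))         ≈⟨ signed-cong b (*-congˡ x⇄z) ⟩
    signed b (y * signed c (z * x))  ≈⟨ signed-cong b (signed-*ʳ c y (z * x)) ⟩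
    signed b (signed c (y * (z * x)))  ≈⟨ signed-xor b c (y * (z * x)) ⟩
    signed (b xor c) (y * (z * x)) ≈⟨ signed-cong (b xor c) (*-assoc y z x) ⟨
    signed (b xor c) (y * z * x)   ∎

  *-inverseʳ : ∀ {x y u v} → x * u ≈ 1# → y * v ≈ 1# → (x * y) * (v * u) ≈ 1#
  *-inverseʳ {x} {y} {u} {v} xu yv = begin
    (x * y) * (v * u)   ≈⟨ *-assoc x y (v * u) ⟩
    x * (y * (v * u))   ≈⟨ *-congˡ (*-assoc y v u) ⟨
    x * (y * v * u)     ≈⟨ *-congˡ (*-congʳ yv) ⟩
    x * (1# * u)        ≈⟨ *-congˡ (*-identityˡ u) ⟩
    x * u               ≈⟨ xu ⟩
    1#                  ∎

-- Monomials in the generators and their commutation rules.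

module Clifford (K : CommutativeRing c ℓ) {n : ℕ} (G : Graph n) where
  private module K = CommutativeRing K
  open Graph G
  open CliffordPresentation K G
  open Algebra algebra
    using (ring; setoid; *-congˡ; *-congʳ; +-congˡ; +-congʳ; zeroˡ; zeroʳ; +-identityʳ;
           -‿inverseʳ; -‿homo)
  open RingProperties ring
    using (-‿distribˡ-*; -‿distribʳ-*; -‿involutive; -‿+-comm; -1*x≈-x)
  open Sign ring
  open SetoidReasoning setoid

  0# 1# : Expr
  0# = scalar K.0#
  1# = scalar K.1#

  adj : Matrix₂ n n
  adj i j = does (adjacent? i j)

  adj-irrefl : ∀ i → adj i i ≡ false
  adj-irrefl i with adjacent? i i
  ... | yes i~i = contradiction i~i (loopless ≡.refl)
  ... | no  _   = ≡.refl

  adj-sym : ∀ i j → adj i j ≡ adj j i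
  adj-sym i j with adjacent? i j | adjacent? j i
  ... | yes _   | yes _   = ≡.refl
  ... | no  _   | no  _   = ≡.refl
  ... | yes i~j | no  j≁i = contradiction (symmetric i~j) j≁i
  ... | no  i≁j | yes j~i = contradiction (symmetric j~i) i≁j

  e-⇄ : ∀ i j → e i ⇄[ adj i j ] e j
  e-⇄ i j with i ≟ j
  ... | yes ≡.refl rewrite adj-irrefl i = refl
  ... | no  i≢j with adjacent? i j
  ...   | yes i~j = anticommute i≢j i~j
  ...   | no  i≁j = commute i≢j i≁j

  scalar-⇄ : ∀ k x → x ⇄[ false ] scalar k
  scalar-⇄ k x = sym (scalar-central k x)

  power : Fin n → Bool → Expr
  power i b = if b then e i else 1#

  power-⇄ : ∀ i j b → e i ⇄[ adj i j ∧ b ] power j b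
  power-⇄ i j true  rewrite ∧-identityʳ (adj i j) = e-⇄ i j
  power-⇄ i j false rewrite ∧-zeroʳ (adj i j) = scalar-⇄ K.1# (e i)

  -- The map `ι` says which generators the positions of the word stand for, so that the recursion on
  -- the word stays inside one algebra. The monomial e_S is the case `ι = id`.
  monomial : (Fin m → Fin n) → Word m → Expr
  monomial ι []      = 1#
  monomial ι (b ∷ S) = power (ι zero) b * monomial (ι ∘ suc) S

  monomial-⇄ : ∀ i (ι : Fin m → Fin n) S → e i ⇄[ (adj i ∘ ι) ∙ lookup S ] monomial ι S
  monomial-⇄ i ι []      = scalar-⇄ K.1# (e i)
  monomial-⇄ i ι (b ∷ S) = ⇄-* (power-⇄ i (ι zero) b) (monomial-⇄ i (ι ∘ suc) S)

  -- The generator moves past the earlier factors at the cost of a sign. At its own position it is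
  -- inserted, or it meets itself and squares to -1.
  e-monomial : ∀ (ι : Fin m → Fin n) i S →
               ∃ λ b → e (ι i) * monomial ι S ≈ signed b (monomial ι (flip i S))
  e-monomial ι zero (true ∷ S) = true , (begin
    e (ι zero) * (e (ι zero) * M)   ≈⟨ *-assoc _ _ _ ⟨
    e (ι zero) * e (ι zero) * M     ≈⟨ *-congʳ (square (ι zero)) ⟩
    - 1# * M                        ≈⟨ -‿distribˡ-* 1# M ⟨
    - (1# * M)                      ∎)
    where M = monomial (ι ∘ suc) S
  e-monomial ι zero (false ∷ S) = false , *-congˡ (*-identityˡ _)
  e-monomial ι (suc i) (b ∷ S) =
    let s = adj (ι (suc i)) (ι zero) ∧ b
        t , eq = e-monomial (ι ∘ suc) i S
        p = power (ι zero) b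
        M = monomial (ι ∘ suc) S
        M′ = monomial (ι ∘ suc) (flip i S)
        E = e (ι (suc i))
    in s xor t , (begin
      E * (p * M)               ≈⟨ *-assoc E p M ⟨
      E * p * M                 ≈⟨ *-congʳ (power-⇄ (ι (suc i)) (ι zero) b) ⟩
      signed s (p * E) * M      ≈⟨ signed-*ˡ s (p * E) M ⟩
      signed s (p * E * M)      ≈⟨ signed-cong s (*-assoc p E M) ⟩
      signed s (p * (E * M))    ≈⟨ signed-cong s (*-congˡ eq) ⟩
      signed s (p * signed t M′)    ≈⟨ signed-cong s (signed-*ʳ t p M′) ⟩
      signed s (signed t (p * M′))  ≈⟨ signed-xor s t (p * M′) ⟩
      signed (s xor t) (p * M′)     ∎)

  monomial-1 : (ι : Fin m → Fin n) → monomial ι (replicate m false) ≈ 1#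
  monomial-1 {zero}  ι = refl
  monomial-1 {suc m} ι = trans (*-identityˡ _) (monomial-1 (ι ∘ suc))

  power-invertible : ∀ i b → ∃ λ y → power i b * y ≈ 1#
  power-invertible i true  = - e i , (begin
    e i * - e i     ≈⟨ -‿distribʳ-* (e i) (e i) ⟨
    - (e i * e i)   ≈⟨ -‿cong (square i) ⟩
    - - 1#          ≈⟨ -‿involutive 1# ⟩
    1#              ∎)
  power-invertible i false = 1# , *-identityˡ 1#

  monomial-invertible : ∀ (ι : Fin m → Fin n) S → ∃ λ y → monomial ι S * y ≈ 1#
  monomial-invertible ι []      = 1# , *-identityˡ 1#
  monomial-invertible ι (b ∷ S) =
    let y , py = power-invertible (ι zero) b
        z , mz = monomial-invertible (ι ∘ suc) S
    in z * y , *-inverseʳ py mz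

  -- The expressions commuting with `z` form a subalgebra, so it suffices that it contains the
  -- generators.
  generators-central : ∀ {z} → (∀ i → e i * z ≈ z * e i) → IsCentral algebra z
  generators-central ez (scalar k) = sym (scalar-central k _)
  generators-central ez (e i)      = sym (ez i)
  generators-central {z} ez (x + y) = begin
    z * (x + y)      ≈⟨ distribˡ z x y ⟩
    z * x + z * y    ≈⟨ +-cong (generators-central ez x) (generators-central ez y) ⟩
    x * z + y * z    ≈⟨ distribʳ z x y ⟨
    (x + y) * z      ∎
  generators-central {z} ez (x * y) = begin
    z * (x * y)      ≈⟨ *-assoc z x y ⟨
    z * x * y        ≈⟨ *-congʳ (generators-central ez x) ⟩
    x * z * y        ≈⟨ *-assoc x z y ⟩
    x * (z * y)      ≈⟨ *-congˡ (generators-central ez y) ⟩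
    x * (y * z)      ≈⟨ *-assoc x y z ⟨
    x * y * z        ∎
  generators-central {z} ez (- x) = begin
    z * - x          ≈⟨ -‿distribʳ-* z x ⟨
    - (z * x)        ≈⟨ -‿cong (generators-central ez x) ⟩
    - (x * z)        ≈⟨ -‿distribˡ-* x z ⟩
    - x * z          ∎

  kernel⇒central : ∀ S → (∀ i → adj i ∙ lookup S ≡ false) → IsCentral algebra (monomial id S)
  kernel⇒central S AS≡0 = generators-central λ i →
    ≡.subst (λ b → e i ⇄[ b ] monomial id S) (AS≡0 i) (monomial-⇄ i id S)

  -- Linear spans of monomials with words in a given set.

  data Span (P : Pred (Word n) 0ℓ) : Expr → Set (c ⊔ ℓ) where
    term : ∀ k {S} → P S → Span P (scalar k * monomial id S)
    zero : Span P 0#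
    _⊕_  : ∀ {x y} → Span P x → Span P y → Span P (x + y)
    resp : ∀ {x y} → x ≈ y → Span P x → Span P y

  Span-⊆ : ∀ {P Q : Pred (Word n) 0ℓ} {x} → (∀ {S} → P S → Q S) → Span P x → Span Q x
  Span-⊆ f (term k p) = term k (f p)
  Span-⊆ f zero       = zero
  Span-⊆ f (p ⊕ q)    = Span-⊆ f p ⊕ Span-⊆ f q
  Span-⊆ f (resp x≈y p) = resp x≈y (Span-⊆ f p)

  Span-scalar : ∀ {P x} k → Span P x → Span P (scalar k * x)
  Span-scalar k (term l p)   = resp (trans (*-congʳ (scalar-* k l)) (*-assoc _ _ _)) (term (k K.* l) p)
  Span-scalar k zero         = resp (sym (zeroʳ _)) zero
  Span-scalar k (p ⊕ q)      = resp (sym (distribˡ _ _ _)) (Span-scalar k p ⊕ Span-scalar k q)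
  Span-scalar k (resp x≈y p) = resp (*-congˡ x≈y) (Span-scalar k p)

  -1#*x≈-x : ∀ x → scalar (K.- K.1#) * x ≈ - x
  -1#*x≈-x x = trans (*-congʳ (-‿homo K.1#)) (-1*x≈-x x)

  Span-neg : ∀ {P x} → Span P x → Span P (- x)
  Span-neg p = resp (-1#*x≈-x _) (Span-scalar (K.- K.1#) p)

  Span-signed : ∀ {P x} b → Span P x → Span P (signed b x)
  Span-signed true  = Span-neg
  Span-signed false = id

  Everything : Pred (Word n) 0ℓ
  Everything _ = ⊤

  Span-monomial : ∀ {P} S → P S → Span P (monomial id S)
  Span-monomial S p = resp (*-identityˡ _) (term K.1# p)

  scalar-shift : ∀ k x y → x * (scalar k * y) ≈ scalar k * (x * y)
  scalar-shift k x y = begin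
    x * (scalar k * y)   ≈⟨ *-assoc x (scalar k) y ⟨
    x * scalar k * y     ≈⟨ *-congʳ (scalar-central k x) ⟨
    scalar k * x * y     ≈⟨ *-assoc (scalar k) x y ⟩
    scalar k * (x * y)   ∎

  Span-e : ∀ {x} i → Span Everything x → Span Everything (e i * x)
  Span-e i (term k {S} _) =
    let b , eq = e-monomial id i S in
    resp (trans (*-congˡ (sym eq)) (sym (scalar-shift k (e i) _)))
      (Span-scalar k (Span-signed b (Span-monomial (flip i S) tt)))
  Span-e i zero         = resp (sym (zeroʳ (e i))) zero
  Span-e i (p ⊕ q)      = resp (sym (distribˡ _ _ _)) (Span-e i p ⊕ Span-e i q)
  Span-e i (resp x≈y p) = resp (*-congˡ x≈y) (Span-e i p)

  Span-* : ∀ x {y} → Span Everything y → Span Everything (x * y)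
  Span-* (scalar k) p = Span-scalar k p
  Span-* (e i)      p = Span-e i p
  Span-* (x + x′)   p = resp (sym (distribʳ _ x x′)) (Span-* x p ⊕ Span-* x′ p)
  Span-* (x * x′)   p = resp (sym (*-assoc x x′ _)) (Span-* x (Span-* x′ p))
  Span-* (- x)      p = resp (-‿distribˡ-* x _) (Span-neg (Span-* x p))

  -- The span of all monomials is a left ideal and contains 1, the monomial of the zero word.
  spanning : ∀ x → Span Everything x
  spanning x = resp (trans (*-congˡ (monomial-1 id)) (*-identityʳ x))
    (Span-* x (Span-monomial (replicate n false) tt))

  Span-scalars : ∀ {P x} → (∀ {S} → P S → S ≡ replicate n false) → Span P x → ∃ λ k → x ≈ scalar k
  Span-scalars {P} P⇒0 (term k {S} p) = k , trans
    (*-congˡ (trans (monomial-≡ (P⇒0 p)) (monomial-1 id))) (*-identityʳ _)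
    where
    monomial-≡ : ∀ {S T} → S ≡ T → monomial id S ≈ monomial id T
    monomial-≡ ≡.refl = refl
  Span-scalars P⇒0 zero = K.0# , refl
  Span-scalars P⇒0 (p ⊕ q) =
    let k , x≈k = Span-scalars P⇒0 p
        l , y≈l = Span-scalars P⇒0 q
    in k K.+ l , trans (+-cong x≈k y≈l) (sym (scalar-+ k l))
  Span-scalars P⇒0 (resp x≈y p) =
    let k , x≈k = Span-scalars P⇒0 p in k , trans (sym x≈y) x≈k

  -- Averaging over conjugation, and the center for a trivial kernel.

  module Averaging (½ : K.Carrier) (½+½≈1 : ½ K.+ ½ K.≈ K.1#) where

    halve-double : ∀ x → scalar ½ * (x + x) ≈ x
    halve-double x = begin
      scalar ½ * (x + x)             ≈⟨ distribˡ _ x x ⟩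
      scalar ½ * x + scalar ½ * x    ≈⟨ distribʳ x _ _ ⟨
      (scalar ½ + scalar ½) * x      ≈⟨ *-congʳ (scalar-+ ½ ½) ⟨
      scalar (½ K.+ ½) * x           ≈⟨ *-congʳ (scalar-cong ½+½≈1) ⟩
      1# * x                         ≈⟨ *-identityˡ x ⟩
      x                              ∎

    -- Since e i is inverse to - e i, this is the projection onto the
    -- commutant of e i that averages x with its conjugate.
    average : Fin n → Expr → Expr
    average i x = scalar ½ * (x + - (e i * x * e i))

    average-cong : ∀ i {x y} → x ≈ y → average i x ≈ average i y
    average-cong i x≈y = *-congˡ (+-cong x≈y (-‿cong (*-congʳ (*-congˡ x≈y))))

    average-+ : ∀ i x y → average i (x + y) ≈ average i x + average i y
    average-+ i x y = trans (*-congˡ (begin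
      x + y + - (e i * (x + y) * e i)
        ≈⟨ +-congˡ (-‿cong (trans (*-congʳ (distribˡ (e i) x y)) (distribʳ (e i) _ _))) ⟩
      x + y + - (e i * x * e i + e i * y * e i)
        ≈⟨ +-congˡ (-‿+-comm _ _) ⟨
      x + y + (- (e i * x * e i) + - (e i * y * e i))
        ≈⟨ +-assoc x y _ ⟩
      x + (y + (- (e i * x * e i) + - (e i * y * e i)))
        ≈⟨ +-congˡ (trans (sym (+-assoc y _ _)) (trans (+-congʳ (+-comm y _)) (+-assoc _ y _))) ⟩
      x + (- (e i * x * e i) + (y + - (e i * y * e i)))
        ≈⟨ +-assoc x _ _ ⟨
      x + - (e i * x * e i) + (y + - (e i * y * e i)) ∎))
      (distribˡ _ _ _)

    -- Moving the left factor past `x` costs the sign `b` and leaves the square of `e i`, whose -1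
    -- cancels the outer minus.
    conjugate : ∀ i b {x} → e i ⇄[ b ] x → - (e i * x * e i) ≈ signed b x
    conjugate i b {x} ei⇄x = begin
      - (e i * x * e i)               ≈⟨ -‿cong (*-congʳ ei⇄x) ⟩
      - (signed b (x * e i) * e i)    ≈⟨ -‿cong (signed-*ˡ b _ _) ⟩
      - signed b (x * e i * e i)      ≈⟨ -‿cong (signed-cong b (*-assoc x _ _)) ⟩
      - signed b (x * (e i * e i))    ≈⟨ -‿cong (signed-cong b (*-congˡ (square i))) ⟩
      - signed b (x * - 1#)           ≈⟨ -‿cong (signed-cong b (-‿distribʳ-* x 1#)) ⟨
      - signed b (- (x * 1#))         ≈⟨ -‿cong (signed-cong b (-‿cong (*-identityʳ x))) ⟩
      - signed b (- x)                ≈⟨ lemma b ⟩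
      signed b x                      ∎
      where
      lemma : ∀ b → - signed b (- x) ≈ signed b x
      lemma true  = -‿cong (-‿involutive x)
      lemma false = -‿involutive x

    average-commuting : ∀ i {x} → e i * x ≈ x * e i → average i x ≈ x
    average-commuting i ei⇄x = trans (*-congˡ (+-congˡ (conjugate i false ei⇄x))) (halve-double _)

    average-anticommuting : ∀ i {x} → e i ⇄[ true ] x → average i x ≈ 0#
    average-anticommuting i ei⇄x =
      trans (*-congˡ (trans (+-congˡ (conjugate i true ei⇄x)) (-‿inverseʳ _))) (zeroʳ _)

    -- Averaging fixes the terms commuting with `e i` and annihilates those anticommuting with it.
    -- The surviving words are those satisfying the kernel equation of row `i`.
    Span-average : ∀ {P x} i → Span P x →
                   Span (λ S → adj i ∙ lookup S ≡ false × P S) (average i x)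
    Span-average i (term k {S} p)
      with adj i ∙ lookup S in eq | ⇄-* (scalar-⇄ k (e i)) (monomial-⇄ i id S)
    ... | true  | ei⇄ = resp (sym (average-anticommuting i ei⇄)) zero
    ... | false | ei⇄ = resp (sym (average-commuting i ei⇄)) (term k (eq , p))
    Span-average i zero = resp (sym (average-commuting i (trans (zeroʳ _) (sym (zeroˡ _))))) zero
    Span-average i (p ⊕ q) = resp (sym (average-+ i _ _)) (Span-average i p ⊕ Span-average i q)
    Span-average i (resp x≈y p) = resp (average-cong i x≈y) (Span-average i p)

    -- A central element equals each of its averages, so every vertex in the list imposes its kernel
    -- equation on the words representing that same element.
    Span-central : ∀ {z} → IsCentral algebra z → (is : List (Fin n)) →
                   Span (λ S → All (λ i → adj i ∙ lookup S ≡ false) is) z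
    Span-central z-central []       = Span-⊆ (λ _ → []) (spanning _)
    Span-central z-central (i ∷ is) = Span-⊆ (λ (p , ps) → p ∷ ps)
      (resp (average-commuting i (sym (z-central (e i)))) (Span-average i (Span-central z-central is)))

    central⇒scalar : (∀ S → (∀ i → adj i ∙ lookup S ≡ false) → S ≡ replicate n false) →
                     ∀ {z} → IsCentral algebra z → ∃ λ k → z ≈ scalar k
    central⇒scalar kernel-trivial z-central = Span-scalars
      (λ {S} ps → kernel-trivial S (λ i → All.lookup ps (∈-allFin i)))
      (Span-central z-central (allFin n))

  -- A representation on functions of words, separating elements of the algebra.

  -- c(i,j) + c(j,i) = a(i,j) for i ≠ j and c(i,i) = 1 modulo 2, so that c is
  -- the sign cocycle of the basis of ordered monomials.
  cocycle : Matrix₂ n n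
  cocycle i j with <-cmp i j
  ... | tri< _ _ _ = false
  ... | tri≈ _ _ _ = true
  ... | tri> _ _ _ = adj i j

  cocycle-diagonal : ∀ i → cocycle i i ≡ true
  cocycle-diagonal i with <-cmp i i
  ... | tri< _ i≢i _ = contradiction ≡.refl i≢i
  ... | tri≈ _ _ _   = ≡.refl
  ... | tri> _ i≢i _ = contradiction ≡.refl i≢i

  cocycle-adj : ∀ {i j} → i ≢ j → cocycle i j xor cocycle j i ≡ adj i j
  cocycle-adj {i} {j} i≢j with <-cmp i j | <-cmp j i
  ... | tri≈ _ i≡j _   | _              = contradiction i≡j i≢j
  ... | _              | tri≈ _ j≡i _   = contradiction (≡.sym j≡i) i≢j
  ... | tri< i<j _ _   | tri< _ _ i≮j   = contradiction i<j i≮j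
  ... | tri> j≮i _ _   | tri> _ _ j<i   = contradiction j<i j≮i
  ... | tri< _ _ _     | tri> _ _ _     = adj-sym j i
  ... | tri> _ _ _     | tri< _ _ _     = xor-identityʳ (adj i j)

  open Sign K.ring using () renaming
    ( signed to signedᴷ; signed-cong to signedᴷ-cong; signed-xor to signedᴷ-xor
    ; signed-*ʳ to signedᴷ-*ʳ; signed-+ to signedᴷ-+; signed-0 to signedᴷ-0 )
  private module KP = RingProperties K.ring

  -- The regular representation in coordinates with respect to the monomials.
  ⟦_⟧ : Expr → (Word n → K.Carrier) → Word n → K.Carrier
  ⟦ scalar k ⟧ f S = k K.* f S
  ⟦ e i ⟧      f S = signedᴷ (cocycle i ∙ lookup S) (f (flip i S))
  ⟦ x + y ⟧    f S = ⟦ x ⟧ f S K.+ ⟦ y ⟧ f S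
  ⟦ x * y ⟧    f S = ⟦ x ⟧ (⟦ y ⟧ f) S
  ⟦ - x ⟧      f S = K.- ⟦ x ⟧ f S

  ⟦⟧-cong : ∀ x {f g} → (∀ S → f S K.≈ g S) → ∀ S → ⟦ x ⟧ f S K.≈ ⟦ x ⟧ g S
  ⟦⟧-cong (scalar k) f≈g S = K.*-congˡ (f≈g S)
  ⟦⟧-cong (e i)      f≈g S = signedᴷ-cong (cocycle i ∙ lookup S) (f≈g (flip i S))
  ⟦⟧-cong (x + y)    f≈g S = K.+-cong (⟦⟧-cong x f≈g S) (⟦⟧-cong y f≈g S)
  ⟦⟧-cong (x * y)    f≈g S = ⟦⟧-cong x (⟦⟧-cong y f≈g) S
  ⟦⟧-cong (- x)      f≈g S = K.-‿cong (⟦⟧-cong x f≈g S)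

  +-interchange : ∀ a b c d → (a K.+ b) K.+ (c K.+ d) K.≈ (a K.+ c) K.+ (b K.+ d)
  +-interchange = interchange
    where open CommutativeSemigroupProperties K.+-commutativeSemigroup using (interchange)

  ⟦⟧-+ : ∀ x f g S → ⟦ x ⟧ (λ T → f T K.+ g T) S K.≈ ⟦ x ⟧ f S K.+ ⟦ x ⟧ g S
  ⟦⟧-+ (scalar k) f g S = K.distribˡ k (f S) (g S)
  ⟦⟧-+ (e i)      f g S = signedᴷ-+ (cocycle i ∙ lookup S) _ _
  ⟦⟧-+ (x + y)    f g S = K.trans (K.+-cong (⟦⟧-+ x f g S) (⟦⟧-+ y f g S)) (+-interchange _ _ _ _)
  ⟦⟧-+ (x * y)    f g S = K.trans (⟦⟧-cong x (⟦⟧-+ y f g) S) (⟦⟧-+ x (⟦ y ⟧ f) (⟦ y ⟧ g) S)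
  ⟦⟧-+ (- x)      f g S = K.trans (K.-‿cong (⟦⟧-+ x f g S)) (K.sym (KP.-‿+-comm _ _))

  ⟦⟧-scale : ∀ x k f S → k K.* ⟦ x ⟧ f S K.≈ ⟦ x ⟧ (λ T → k K.* f T) S
  ⟦⟧-scale (scalar l) k f S = x∙yz≈y∙xz k l (f S)
    where open CommutativeSemigroupProperties K.*-commutativeSemigroup using (x∙yz≈y∙xz)
  ⟦⟧-scale (e i)      k f S = signedᴷ-*ʳ (cocycle i ∙ lookup S) k _
  ⟦⟧-scale (x + y)    k f S = K.trans (K.distribˡ k _ _) (K.+-cong (⟦⟧-scale x k f S) (⟦⟧-scale y k f S))
  ⟦⟧-scale (x * y)    k f S = K.trans (⟦⟧-scale x k (⟦ y ⟧ f) S) (⟦⟧-cong x (⟦⟧-scale y k f) S)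
  ⟦⟧-scale (- x)      k f S = K.trans (K.sym (KP.-‿distribʳ-* k _)) (K.-‿cong (⟦⟧-scale x k f S))

  signedᴷ-≡ : ∀ {b c x y} → b ≡ c → x ≡ y → signedᴷ b x K.≈ signedᴷ c y
  signedᴷ-≡ ≡.refl ≡.refl = K.refl

  -- The sign of `e j` is read at `flip i S` instead of `S`, which contributes `cocycle j i`.
  ⟦e*e⟧ : ∀ i j f S → ⟦ e i * e j ⟧ f S K.≈
          signedᴷ (cocycle i ∙ lookup S xor (cocycle j i xor cocycle j ∙ lookup S)) (f (flip j (flip i S)))
  ⟦e*e⟧ i j f S = K.trans (signedᴷ-xor (cocycle i ∙ lookup S) _ _)
    (signedᴷ-≡ (≡.cong (cocycle i ∙ lookup S xor_) (∙-flip (cocycle j) i S)) ≡.refl)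

  ⟦⟧-square : ∀ i f S → ⟦ e i * e i ⟧ f S K.≈ K.- (K.1# K.* f S)
  ⟦⟧-square i f S = K.trans (⟦e*e⟧ i i f S) (K.trans
    (signedᴷ-≡
      (≡.trans (≡.cong (λ b → p xor (b xor p)) (cocycle-diagonal i)) (lemma p))
      (≡.cong f (≡.trans (updateAt-updateAt i S) (updateAt-id-local i S (not-involutive _)))))
    (K.-‿cong (K.sym (K.*-identityˡ (f S)))))
    where
    p = cocycle i ∙ lookup S
    lemma : ∀ p → p xor (true xor p) ≡ true
    lemma true  = ≡.refl
    lemma false = ≡.refl

  -- The signs for the two orders differ by `cocycle i j xor cocycle j i`, which is the adjacency
  -- bit.
  ⟦⟧-swap : ∀ {i j} → i ≢ j → ∀ f S →
    ⟦ e i * e j ⟧ f S K.≈ signedᴷ (adj i j) (⟦ e j * e i ⟧ f S)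
  ⟦⟧-swap {i} {j} i≢j f S = K.trans (⟦e*e⟧ i j f S) (K.trans
    (signedᴷ-≡
      (≡.trans
        (solve 4 (λ p q c d → p :+ (d :+ q) := (c :+ d) :+ (q :+ (c :+ p))) ≡.refl
          (cocycle i ∙ lookup S) (cocycle j ∙ lookup S) (cocycle i j) (cocycle j i))
        (≡.cong (_xor (cocycle j ∙ lookup S xor (cocycle i j xor cocycle i ∙ lookup S)))
          (cocycle-adj i≢j)))
      (≡.cong f (updateAt-commutes j i (i≢j ∘ ≡.sym) S)))
    (K.trans (K.sym (signedᴷ-xor (adj i j) _ _))
      (signedᴷ-cong (adj i j) (K.sym (⟦e*e⟧ j i f S)))))
    where open Bool.xor-∧-Solver

  adjacent⇒adj : ∀ {i j} → Adjacent i j → adj i j ≡ true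
  adjacent⇒adj {i} {j} i~j with adjacent? i j
  ... | yes _  = ≡.refl
  ... | no i≁j = contradiction i~j i≁j

  nonadjacent⇒adj : ∀ {i j} → ¬ Adjacent i j → adj i j ≡ false
  nonadjacent⇒adj {i} {j} i≁j with adjacent? i j
  ... | yes i~j = contradiction i~j i≁j
  ... | no  _   = ≡.refl

  -- Every axiom and every defining relation holds for the operators. Elements of the presented
  -- algebra can thus be told apart by their action.
  ⟦⟧-sound : ∀ {x y} → x ≈ y → ∀ f S → ⟦ x ⟧ f S K.≈ ⟦ y ⟧ f S
  ⟦⟧-sound refl f S = K.refl
  ⟦⟧-sound (sym p) f S = K.sym (⟦⟧-sound p f S)
  ⟦⟧-sound (trans p q) f S = K.trans (⟦⟧-sound p f S) (⟦⟧-sound q f S)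
  ⟦⟧-sound (+-cong p q) f S = K.+-cong (⟦⟧-sound p f S) (⟦⟧-sound q f S)
  ⟦⟧-sound (*-cong {x} {y} {u} {v} p q) f S =
    K.trans (⟦⟧-cong x (⟦⟧-sound q f) S) (⟦⟧-sound p (⟦ v ⟧ f) S)
  ⟦⟧-sound (-‿cong p) f S = K.-‿cong (⟦⟧-sound p f S)
  ⟦⟧-sound (+-assoc x y z) f S = K.+-assoc _ _ _
  ⟦⟧-sound (+-comm x y) f S = K.+-comm _ _
  ⟦⟧-sound (+-identityˡ x) f S = K.trans (K.+-congʳ (K.zeroˡ _)) (K.+-identityˡ _)
  ⟦⟧-sound (-‿inverseˡ x) f S = K.trans (K.-‿inverseˡ _) (K.sym (K.zeroˡ _))
  ⟦⟧-sound (*-assoc x y z) f S = K.refl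
  ⟦⟧-sound (*-identityˡ x) f S = K.*-identityˡ _
  ⟦⟧-sound (*-identityʳ x) f S = ⟦⟧-cong x (λ T → K.*-identityˡ (f T)) S
  ⟦⟧-sound (distribˡ x y z) f S = ⟦⟧-+ x (⟦ y ⟧ f) (⟦ z ⟧ f) S
  ⟦⟧-sound (distribʳ x y z) f S = K.refl
  ⟦⟧-sound (scalar-cong k≈l) f S = K.*-congʳ k≈l
  ⟦⟧-sound (scalar-+ k l) f S = K.distribʳ (f S) k l
  ⟦⟧-sound (scalar-* k l) f S = K.*-assoc k l (f S)
  ⟦⟧-sound (scalar-central k x) f S = ⟦⟧-scale x k f S
  ⟦⟧-sound (square i) f S = ⟦⟧-square i f S
  ⟦⟧-sound (anticommute {i} {j} i≢j i~j) f S =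
    K.trans (⟦⟧-swap i≢j f S) (signedᴷ-≡ (adjacent⇒adj i~j) ≡.refl)
  ⟦⟧-sound (commute {i} {j} i≢j i≁j) f S =
    K.trans (⟦⟧-swap i≢j f S) (signedᴷ-≡ (nonadjacent⇒adj i≁j) ≡.refl)

  -- The constant term, and gradings by the bits of a word.

  δ : ∀ {m} → Word m → K.Carrier
  δ []          = K.1#
  δ (true  ∷ S) = K.0#
  δ (false ∷ S) = δ S

  δ-zeros : ∀ m → δ (replicate m false) ≡ K.1#
  δ-zeros zero    = ≡.refl
  δ-zeros (suc m) = δ-zeros m

  δ-nonzero : ∀ {m} (i : Fin m) S → lookup S i ≡ true → δ S ≡ K.0#
  δ-nonzero zero    (true  ∷ S) eq = ≡.refl
  δ-nonzero (suc i) (true  ∷ S) eq = ≡.refl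
  δ-nonzero (suc i) (false ∷ S) eq = δ-nonzero i S eq

  -- Since `δ` is the coordinate vector of 1, this is the coefficient of the empty monomial.
  constantTerm : Expr → K.Carrier
  constantTerm x = ⟦ x ⟧ δ (replicate n false)

  constantTerm-cong : ∀ {x y} → x ≈ y → constantTerm x K.≈ constantTerm y
  constantTerm-cong x≈y = ⟦⟧-sound x≈y δ (replicate n false)

  constantTerm-scalar : ∀ k → constantTerm (scalar k) K.≈ k
  constantTerm-scalar k = K.trans (K.*-congˡ (K.reflexive (δ-zeros n))) (K.*-identityʳ k)

  scalar-injective : ∀ {k l} → scalar k ≈ scalar l → k K.≈ l
  scalar-injective k≈l = K.trans (K.sym (constantTerm-scalar _))
    (K.trans (constantTerm-cong k≈l) (constantTerm-scalar _))

  SupportedOn : Fin n → Bool → (Word n → K.Carrier) → Set ℓ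
  SupportedOn i b f = ∀ S → lookup S i ≡ not b → f S K.≈ K.0#

  -- Homogeneity of degree `b` for the grading of functions by the bit at `i`. It locates the
  -- support of an image without computing signs.
  Shifts : Fin n → Bool → Expr → Set (c ⊔ ℓ)
  Shifts i b x = ∀ f d → SupportedOn i d f → SupportedOn i (b xor d) (⟦ x ⟧ f)

  shifts-scalar : ∀ i k → Shifts i false (scalar k)
  shifts-scalar i k f d f⊆d S eq = K.trans (K.*-congˡ (f⊆d S eq)) (K.zeroʳ k)

  shifts-e : ∀ i j → Shifts i (does (i ≟ j)) (e j)
  shifts-e i j f d f⊆d S eq with i ≟ j
  ... | yes ≡.refl = signedᴷ-0 (cocycle i ∙ lookup S) (f⊆d (flip i S)
    (≡.trans (lookup∘updateAt i S) (≡.trans (≡.cong not eq) (not-involutive (not d)))))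
  ... | no i≢j = signedᴷ-0 (cocycle j ∙ lookup S)
    (f⊆d (flip j S) (≡.trans (lookup∘updateAt′ i j i≢j S) eq))

  shifts-* : ∀ i b c x y → Shifts i b x → Shifts i c y → Shifts i (b xor c) (x * y)
  shifts-* i b c x y xb yc f d f⊆d S eq =
    xb (⟦ y ⟧ f) (c xor d) (yc f d f⊆d) S (≡.trans eq (≡.cong not (xor-assoc b c d)))

  shifts-power : ∀ i j b → Shifts i (does (i ≟ j) ∧ b) (power j b)
  shifts-power i j true  rewrite ∧-identityʳ (does (i ≟ j)) = shifts-e i j
  shifts-power i j false rewrite ∧-zeroʳ (does (i ≟ j)) = shifts-scalar i K.1#

  shifts-monomial : ∀ i (ι : Fin m → Fin n) S →
    Shifts i ((λ j → does (i ≟ ι j)) ∙ lookup S) (monomial ι S)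
  shifts-monomial i ι []      = shifts-scalar i K.1#
  shifts-monomial i ι (b ∷ S) = shifts-* i (does (i ≟ ι zero) ∧ b) _
    (power (ι zero) b) (monomial (ι ∘ suc) S)
    (shifts-power i (ι zero) b) (shifts-monomial i (ι ∘ suc) S)

  -- At vertex `i` the function `δ` has degree 0 and the monomial degree 1, so the image vanishes on
  -- words whose bit at `i` is false, among them the zero word.
  constantTerm-monomial : ∀ S i → lookup S i ≡ true → constantTerm (monomial id S) K.≈ K.0#
  constantTerm-monomial S i Si = shifts-monomial i id S δ false
    (λ T Ti → K.reflexive (δ-nonzero i T Ti)) (replicate n false)
    (≡.trans (lookup-replicate i false)
      (≡.cong (λ b → not (b xor false)) (≡.sym (≡.trans (indicator-∙ i (lookup S)) Si))))

  -- From the dimension of the center to the parity of the determinant.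

  oneDimensional⇒kernel-trivial : ¬ (K.1# K.≈ K.0#) → HasDimension (centerModule algebra) 1 →
    ∀ S → (∀ i → adj i ∙ lookup S ≡ false) → ∀ i → ¬ (lookup S i ≡ true)
  oneDimensional⇒kernel-trivial 1≉0 (b , spans , _) S AS≡0 i Si =
    let z = proj₁ (b zero)
        M = monomial id S
        ks , 1≈ks*z+0 = spans (1# , generators-central (λ i → trans (*-identityʳ _) (sym (*-identityˡ _))))
        ls , M≈ls*z+0 = spans (M , kernel⇒central S AS≡0)
        k = ks zero
        l = ls zero
        1≈k*z = trans 1≈ks*z+0 (+-identityʳ _)
        M≈l*z = trans M≈ls*z+0 (+-identityʳ _)
        -- With 1 = kz and M = lz, the generator z of the center is eliminated by l = l(kz) = k(lz)
        -- = kM, which avoids inverting k.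
        l≈k*M : scalar l ≈ scalar k * M
        l≈k*M = begin
          scalar l                   ≈⟨ *-identityʳ _ ⟨
          scalar l * 1#              ≈⟨ *-congˡ 1≈k*z ⟩
          scalar l * (scalar k * z)  ≈⟨ scalar-shift k (scalar l) z ⟩
          scalar k * (scalar l * z)  ≈⟨ *-congˡ M≈l*z ⟨
          scalar k * M               ∎
        l≈0 : l K.≈ K.0#
        l≈0 = K.trans (K.sym (constantTerm-scalar l)) (K.trans (constantTerm-cong l≈k*M)
          (K.trans (K.*-congˡ (constantTerm-monomial S i Si)) (K.zeroʳ k)))
        -- Comparing constant terms gave l = 0, so the invertible monomial M would vanish, forcing 1
        -- = 0.
        M≈0 : M ≈ 0#
        M≈0 = trans M≈l*z (trans (*-congʳ (scalar-cong l≈0)) (zeroˡ z))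
        y , M*y≈1 = monomial-invertible id S
    in 1≉0 (scalar-injective (trans (sym M*y≈1) (trans (*-congʳ M≈0) (zeroˡ y))))

  scalarCenter⇒oneDimensional : (∀ {z} → IsCentral algebra z → ∃ λ k → z ≈ scalar k) →
    HasDimension (centerModule algebra) 1
  scalarCenter⇒oneDimensional central⇒scalar =
      (λ _ → 1# , generators-central (λ i → trans (*-identityʳ _) (sym (*-identityˡ _))))
    , (λ (z , z-central) → let k , z≈k = central⇒scalar z-central in
         (λ _ → k) , trans z≈k (sym (k*1+0≈k k)))
    , λ { ks eq zero → scalar-injective (trans (sym (k*1+0≈k (ks zero))) eq) }
    where
    k*1+0≈k : ∀ k → scalar k * 1# + 0# ≈ scalar k
    k*1+0≈k k = trans (+-identityʳ _) (*-identityʳ _)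

  adjacencyMatrix-≡₂ : ∀ i j → adjacencyMatrix G i j ≡₂ adj i j
  adjacencyMatrix-≡₂ i j = ≡₂-bit (adj i j)

  -- The half serves the averaging in the direction from an odd determinant; 1 ≠ 0 serves the
  -- converse, where an invertible monomial cannot vanish.
  oneDimensional⇔odd : (½ : K.Carrier) → ½ K.+ ½ K.≈ K.1# → ¬ (K.1# K.≈ K.0#) →
    HasDimension (centerModule algebra) 1 ⇔ Odd (det (adjacencyMatrix G))
  oneDimensional⇔odd ½ ½+½≈1 1≉0 = mk⇔ to from
    where
    to : HasDimension (centerModule algebra) 1 → Odd (det (adjacencyMatrix G))
    to oneDimensional with det₂ adj in eq | det-≡₂ adjacencyMatrix-≡₂
    ... | true  | odd = odd
    ... | false | _   =
      let v , (i , vi) , Av≡0 = det₂-false⇒kernel adj eq in contradiction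
        (≡.trans (lookup∘tabulate v i) vi)
        (oneDimensional⇒kernel-trivial 1≉0 oneDimensional (tabulate v)
          (λ i → ≡.trans (∙-cong (λ _ → ≡.refl) (lookup∘tabulate v)) (Av≡0 i)) i)

    from : Odd (det (adjacencyMatrix G)) → HasDimension (centerModule algebra) 1
    from odd = scalarCenter⇒oneDimensional (Averaging.central⇒scalar ½ ½+½≈1 λ S AS≡0 →
      lookup-false S (det₂-true⇒leftKernel-trivial adj
        (≡₂-odd (det₂ adj) (det-≡₂ adjacencyMatrix-≡₂) odd)
        -- Left and right kernels agree because `adj` is symmetric.
        (lookup S) λ j → ≡.trans (∙-comm (lookup S) (λ i → adj i j))
          (≡.trans (∙-cong (λ i → adj-sym i j) (λ _ → ≡.refl)) (AS≡0 j))))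
      where
      lookup-false : ∀ {m} (S : Word m) → (∀ i → lookup S i ≡ false) → S ≡ replicate m false
      lookup-false []      S≗0 = ≡.refl
      lookup-false (b ∷ S) S≗0 = ≡.cong₂ _∷_ (S≗0 zero) (lookup-false S (S≗0 ∘ suc))

-- Specialization to the complex numbers.

½ℂ : ℂ
½ℂ = constℝ ½ +i 0ℝ

½+½≈1 : ½ℂ +ℂ ½ℂ ≈ℂ 1ℂ
-- All sequences are constant and their differences evaluate to 0, so the required bound is `0<ε`
-- itself.
½+½≈1 = mk≈ (λ _ 0<ε → 0 , λ _ _ → 0<ε) , mk≈ (λ _ 0<ε → 0 , λ _ _ → 0<ε)

1≉0 : ¬ (1ℂ ≈ℂ 0ℂ)
1≉0 (1≈0 , _) =
  -- Closeness within tolerance 1 would say that the absolute value of 1 - 0 is less than 1.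
  let N , 1<1 = close 1≈0 1ℚ (ℚ.positive⁻¹ 1ℚ) in ℚ.<-irrefl ≡.refl (1<1 N ℕ.≤-refl)

mainTheorem7 : (n : ℕ) .{{_ : NonZero n}} (G : Graph n) →
    HasDimension (centerModule (cliffordGraphAlgebra G)) 1 ⇔ Odd (det (adjacencyMatrix G))
mainTheorem7 n G = Clifford.oneDimensional⇔odd ℂ-commutativeRing G ½ℂ ½+½≈1 1≉0
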